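{- Let $F=(a_0'+b_0x,\ a_1'+b_1x)$ and $G=(a_0''+b_0x,\ a_1''+b_1x)$ (coefficients in $\mathbb{Q}_2$, with the same linear coefficients $b_0,b_1$) be linear-polynomial $2$-adic systems in weak canonical form. Then $$\pi_{F,G}(n)=\frac{a_0'a_1''-a_1'a_0''+n\big((b_0-2)a_1''-(b_1-2)a_0''\big)}{(b_0-2)a_1'-(b_1-2)a_0'}$$ for all $n\in\mathbb{Z}_2$. In particular, if all the coefficients $a_0',a_1',a_0'',a_1'',b_0,b_1$ lie in $\mathbb{Q}\cap\mathbb{Z}_2$, then $\pi_{F,G}(\mathbb{Q}\cap\mathbb{Z}_2)=\mathbb{Q}\cap\mathbb{Z}_2$, and consequently $F$ is ultimately periodic on $\mathbb{Q}\cap\mathbb{Z}_2$ if and only if $G$ is ultimately periodic on $\mathbb{Q}\cap\mathbb{Z}_2$.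
   Context: For $a=\sum_{i\ge0}a_i2^i\in\mathbb{Z}_2$ with $a_i\in\{0,1\}$ let $a\,\%\,2:=a_0$. A $2$-fibred function with domain $\mathbb{Z}_2$ is a pair $F=(F[0],F[1])$ of functions $\mathbb{Z}_2\to\mathbb{Z}_2$, regarded also as a function $F:\mathbb{Z}_2\to\mathbb{Z}_2$ by $F(n)=\dfrac{F[n\%2](n)-(F[n\%2](n)\,\%\,2)}{2}$. Only the values of $F[r]$ on $r+2\mathbb{Z}_2$ matter; $F$ is linear-polynomial, written $F=(a_0+b_0x,a_1+b_1x)$, if $F[r]$ agrees on $r+2\mathbb{Z}_2$ with the polynomial $a_r+b_rx$ over $\mathbb{Q}_2$ for $r=0,1$. $F$ is in weak canonical form if $F[r](r+2\mathbb{Z}_2)\subseteq2\mathbb{Z}_2$ for $r=0,1$ (so that $F(n)=F[n\%2](n)/2$). The $F$-digit expansion of $n$ is $\psi_F(n):=(F^k(n)\,\%\,2)_{k\ge0}$. $F$ is a $2$-adic system if for all integers $k\ge0$ and all $m,n\in\mathbb{Z}_2$: $m\equiv n\pmod{2^k}$ if and only if the first $k$ entries of $\psi_F(m)$ and $\psi_F(n)$ coincide. Then $\psi_F$ is a bijection from $\mathbb{Z}_2$ onto the set of infinite $0$-$1$-sequences, and $\pi_{F,G}:=\psi_G^{ -1}\circ\psi_F:\mathbb{Z}_2\to\mathbb{Z}_2$ for $2$-adic systems $F,G$. A $2$-adic system $F$ is ultimately periodic on a set $A$ if $\{n\in\mathbb{Z}_2\mid\psi_F(n)\text{ is ultimately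 periodic}\}=A$ (purely periodic sequences count as ultimately periodic). -}

module Defs where

open import Algebra.Bundles using (CommutativeRing)
open import Data.Fin.Base using (Fin; zero; suc; toℕ; fromℕ<)
import Data.Fin.Properties as Fin
open import Data.Integer.Base as ℤ using (ℤ; +_; _+_; _*_; _-_; -_; _/ℕ_; _%ℕ_)
import Data.Integer.Properties as ℤ
open import Data.Integer.DivMod using (n%ℕd<d; a≡a%ℕn+[a/ℕn]*n)
open import Data.Integer.Divisibility.Signed
open import Data.Integer.Tactic.RingSolver using (solve-∀)
open import Data.Nat.Base as ℕ using (ℕ; zero; suc; NonZero)
open import Data.Nat.GeneralisedArithmetic using (iterate)
import Data.Nat.Properties as ℕ
open import Data.Product.Base using (∃-syntax; _×_; _,_; proj₁; proj₂)
open import Data.Rational.Base using (ℚ; ↥_; ↧_)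
open import Data.Sum.Base using (inj₁; inj₂)
open import Function.Bundles using (Func; _⇔_; module Equivalence; mk⇔)
open import Function.Definitions using (Bijective)
open import Level using (0ℓ)
open import Relation.Binary.Bundles using (Setoid)
open import Relation.Binary.Structures using (IsEquivalence)
open import Relation.Binary.PropositionalEquality
  using (_≡_; _≢_; _≗_; refl; sym; trans; cong; cong₂; subst; subst₂)
open import Relation.Nullary using (¬_; yes; no; contradiction)
open import Relation.Nullary.Decidable using (from-no)
open import Relation.Unary using (Pred; _∈_; _⊢_; _≐_)

private
  ∣-resp : ∀ {d x y} → x ≡ y → d ∣ x → d ∣ y
  ∣-resp refl p = p

  ∣0 : ∀ {d} → d ∣ + 0
  ∣0 = divides (+ 0) refl

2^_ : ℕ → ℤ
2^ k = (+ 2) ℤ.^ k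

2^-nonZero : ∀ k → ℤ.NonZero (2^ k)
2^-nonZero k = ℤ.≢-nonZero λ e → contradiction (ℤ.i^n≡0⇒i≡0 (+ 2) k e) λ ()

2^-+ : ∀ m n → 2^ (m ℕ.+ n) ≡ 2^ m * 2^ n
2^-+ = ℤ.^-distribˡ-+-* (+ 2)

------------------------------------------------------------------------
-- The ring ℤ₂, as the inverse limit of the rings ℤ/2ᵏℤ: the residue of a
-- 2-adic integer modulo 2ᵏ is represented by the integer approx k.

record ℤ₂ : Set where
  no-eta-equality
  constructor mkℤ₂
  field
    approx   : ℕ → ℤ
    coherent : ∀ k → 2^ k ∣ approx (suc k) - approx k

open ℤ₂ public

infix 4 _≡_[mod2^_] _≈₂_

_≡_[mod2^_] : ℤ₂ → ℤ₂ → ℕ → Set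
m ≡ n [mod2^ k ] = 2^ k ∣ approx m k - approx n k

record _≈₂_ (m n : ℤ₂) : Set where
  constructor mk≈₂
  field
    mod : ∀ k → m ≡ n [mod2^ k ]

open _≈₂_ public

coherent* : ∀ x j k → 2^ k ∣ approx x (j ℕ.+ k) - approx x k
coherent* x zero    k = ∣-resp (sym (ℤ.+-inverseʳ (approx x k))) ∣0
coherent* x (suc j) k = ∣-resp
  (identity (approx x (suc j ℕ.+ k)) (approx x (j ℕ.+ k)) (approx x k))
  (∣m∣n⇒∣m+n (∣-trans 2^k∣ (coherent x (j ℕ.+ k))) (coherent* x j k))
  where
  identity : ∀ a b c → (a - b) + (b - c) ≡ a - c
  identity = solve-∀
  2^k∣ : 2^ k ∣ 2^ (j ℕ.+ k)
  2^k∣ = divides (2^ j) (2^-+ j k)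

≈₂-pointwise : ∀ {x y} → (∀ k → approx x k ≡ approx y k) → x ≈₂ y
≈₂-pointwise {x} {y} e = mk≈₂ λ k →
  ∣-resp (sym (ℤ.i≡j⇒i-j≡0 (e k))) ∣0

≈₂-refl : ∀ {x} → x ≈₂ x
≈₂-refl = ≈₂-pointwise λ _ → refl

≈₂-sym : ∀ {x y} → x ≈₂ y → y ≈₂ x
≈₂-sym {x} {y} e = mk≈₂ λ k →
  ∣-resp (identity (approx x k) (approx y k)) (∣m⇒∣-m (mod e k))
  where
  identity : ∀ a b → - (a - b) ≡ b - a
  identity = solve-∀

≈₂-trans : ∀ {x y z} → x ≈₂ y → y ≈₂ z → x ≈₂ z
≈₂-trans {x} {y} {z} e f = mk≈₂ λ k →
  ∣-resp (identity (approx x k) (approx y k) (approx z k))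
    (∣m∣n⇒∣m+n (mod e k) (mod f k))
  where
  identity : ∀ a b c → (a - b) + (b - c) ≡ a - c
  identity = solve-∀

≈₂-isEquivalence : IsEquivalence _≈₂_
≈₂-isEquivalence = record { refl = ≈₂-refl ; sym = ≈₂-sym ; trans = ≈₂-trans }

ℤ₂-setoid : Setoid 0ℓ 0ℓ
ℤ₂-setoid = record { isEquivalence = ≈₂-isEquivalence }

fromℤ : ℤ → ℤ₂
fromℤ z = mkℤ₂ (λ _ → z) (λ _ → ∣-resp (sym (ℤ.+-inverseʳ z)) ∣0)

private
  +-identity : ∀ a b c d → (a - b) + (c - d) ≡ (a + c) - (b + d)
  +-identity = solve-∀

  *-identity : ∀ a b c d → c * (a - b) + b * (c - d) ≡ a * c - b * d
  *-identity = solve-∀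

  neg-identity : ∀ a b → - (a - b) ≡ (- a) - (- b)
  neg-identity = solve-∀

infixl 6 _+₂_
infixl 7 _*₂_
infix  8 -₂_

_+₂_ : ℤ₂ → ℤ₂ → ℤ₂
approx   (x +₂ y) k = approx x k + approx y k
coherent (x +₂ y) k = ∣-resp
  (+-identity (approx x (suc k)) (approx x k) (approx y (suc k)) (approx y k))
  (∣m∣n⇒∣m+n (coherent x k) (coherent y k))

_*₂_ : ℤ₂ → ℤ₂ → ℤ₂
approx   (x *₂ y) k = approx x k * approx y k
coherent (x *₂ y) k = ∣-resp
  (*-identity (approx x (suc k)) (approx x k) (approx y (suc k)) (approx y k))
  (∣m∣n⇒∣m+n (∣n⇒∣m*n (approx y (suc k)) (coherent x k))
             (∣n⇒∣m*n (approx x k) (coherent y k)))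

-₂_ : ℤ₂ → ℤ₂
approx   (-₂ x) k = - approx x k
coherent (-₂ x) k =
  ∣-resp (neg-identity (approx x (suc k)) (approx x k)) (∣m⇒∣-m (coherent x k))

+₂-cong : ∀ {x y u v} → x ≈₂ y → u ≈₂ v → x +₂ u ≈₂ y +₂ v
+₂-cong {x} {y} {u} {v} e f = mk≈₂ λ k → ∣-resp
  (+-identity (approx x k) (approx y k) (approx u k) (approx v k))
  (∣m∣n⇒∣m+n (mod e k) (mod f k))

*₂-cong : ∀ {x y u v} → x ≈₂ y → u ≈₂ v → x *₂ u ≈₂ y *₂ v
*₂-cong {x} {y} {u} {v} e f = mk≈₂ λ k → ∣-resp
  (*-identity (approx x k) (approx y k) (approx u k) (approx v k))
  (∣m∣n⇒∣m+n (∣n⇒∣m*n (approx u k) (mod e k)) (∣n⇒∣m*n (approx y k) (mod f k)))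

-₂-cong : ∀ {x y} → x ≈₂ y → -₂ x ≈₂ -₂ y
-₂-cong {x} {y} e = mk≈₂ λ k →
  ∣-resp (neg-identity (approx x k) (approx y k)) (∣m⇒∣-m (mod e k))

ℤ₂-commutativeRing : CommutativeRing 0ℓ 0ℓ
ℤ₂-commutativeRing = record
  { Carrier = ℤ₂
  ; _≈_     = _≈₂_
  ; _+_     = _+₂_
  ; _*_     = _*₂_
  ; -_      = -₂_
  ; 0#      = fromℤ (+ 0)
  ; 1#      = fromℤ (+ 1)
  ; isCommutativeRing = record
    { isRing = record
      { +-isAbelianGroup = record
        { isGroup = record
          { isMonoid = record
            { isSemigroup = record
              { isMagma = record
                { isEquivalence = ≈₂-isEquivalence ; ∙-cong = +₂-cong }
              ; assoc = λ x y z → ≈₂-pointwise λ k →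
                  ℤ.+-assoc (approx x k) (approx y k) (approx z k)
              }
            ; identity = (λ x → ≈₂-pointwise λ k → ℤ.+-identityˡ (approx x k))
                       , (λ x → ≈₂-pointwise λ k → ℤ.+-identityʳ (approx x k))
            }
          ; inverse = (λ x → ≈₂-pointwise λ k → ℤ.+-inverseˡ (approx x k))
                    , (λ x → ≈₂-pointwise λ k → ℤ.+-inverseʳ (approx x k))
          ; ⁻¹-cong = -₂-cong
          }
        ; comm = λ x y → ≈₂-pointwise λ k → ℤ.+-comm (approx x k) (approx y k)
        }
      ; *-cong = *₂-cong
      ; *-assoc = λ x y z → ≈₂-pointwise λ k →
          ℤ.*-assoc (approx x k) (approx y k) (approx z k)
      ; *-identity = (λ x → ≈₂-pointwise λ k → ℤ.*-identityˡ (approx x k))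
                   , (λ x → ≈₂-pointwise λ k → ℤ.*-identityʳ (approx x k))
      ; distrib = (λ x y z → ≈₂-pointwise λ k →
                    ℤ.*-distribˡ-+ (approx x k) (approx y k) (approx z k))
                , (λ x y z → ≈₂-pointwise λ k →
                    ℤ.*-distribʳ-+ (approx x k) (approx y k) (approx z k))
      }
    ; *-comm = λ x y → ≈₂-pointwise λ k → ℤ.*-comm (approx x k) (approx y k)
    }
  }

2^-cancel : ∀ e {x y} → x *₂ fromℤ (2^ e) ≈₂ y *₂ fromℤ (2^ e) → x ≈₂ y
2^-cancel e {x} {y} p = mk≈₂ λ k →
  let a = approx x (e ℕ.+ k)
      b = approx y (e ℕ.+ k)
      2ᵏ∣a-b : 2^ k ∣ a - b
      2ᵏ∣a-b = *-cancelˡ-∣ (2^ e) {{2^-nonZero e}}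
        (subst₂ _∣_ (2^-+ e k) (factor a b (2^ e)) (mod p (e ℕ.+ k)))
  in ∣-resp (telescope a (approx x k) b (approx y k))
       (∣m∣n⇒∣m+n (∣m∣n⇒∣m-n 2ᵏ∣a-b (coherent* x e k)) (coherent* y e k))
  where
  factor : ∀ a b c → a * c - b * c ≡ c * (a - b)
  factor = solve-∀
  telescope : ∀ a a′ b b′ → ((a - b) - (a - a′)) + (b - b′) ≡ a′ - b′
  telescope = solve-∀

------------------------------------------------------------------------
-- Digits

infix 8 _%2

_%2 : ℤ₂ → Fin 2
n %2 = fromℕ< (n%ℕd<d (approx n 1) 2)

fromDigit : Fin 2 → ℤ₂
fromDigit r = fromℤ (+ toℕ r)

private
  %ℕ2-cong : ∀ a b → + 2 ∣ a - b → a %ℕ 2 ≡ b %ℕ 2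
  %ℕ2-cong a b 2∣ = unique (n%ℕd<d a 2) (n%ℕd<d b 2)
    (∣-resp (identity a b (+ (a %ℕ 2)) (+ (b %ℕ 2)) (a /ℕ 2 * + 2) (b /ℕ 2 * + 2)
              (a≡a%ℕn+[a/ℕn]*n a 2) (a≡a%ℕn+[a/ℕn]*n b 2))
      (∣m∣n⇒∣m+n 2∣ (∣m∣n⇒∣m-n (divides (b /ℕ 2) refl) (divides (a /ℕ 2) refl))))
    where
    identity : ∀ a b r s p q → a ≡ r + p → b ≡ s + q →
               (a - b) + (q - p) ≡ r - s
    identity _ _ r s p q refl refl = cancel r s p q
      where
      cancel : ∀ r s p q → ((r + p) - (s + q)) + (q - p) ≡ r - s
      cancel = solve-∀
    unique : ∀ {r s} → r ℕ.< 2 → s ℕ.< 2 → + 2 ∣ + r - + s → r ≡ s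
    unique {0} {0} _ _ _ = refl
    unique {1} {1} _ _ _ = refl
    unique {0} {1} _ _ p = contradiction p (from-no (+ 2 ∣? - (+ 1)))
    unique {1} {0} _ _ p = contradiction p (from-no (+ 2 ∣? + 1))
    unique {suc (suc _)} (ℕ.s≤s (ℕ.s≤s ())) _ _
    unique {_} {suc (suc _)} _ (ℕ.s≤s (ℕ.s≤s ())) _

  /ℕ2-cong : ∀ k a b → 2^ (suc k) ∣ a - b → 2^ k ∣ a /ℕ 2 - b /ℕ 2
  /ℕ2-cong k a b p = *-cancelˡ-∣ (+ 2) (∣-resp
    (identity a b (+ (a %ℕ 2)) (a /ℕ 2) (b /ℕ 2) (+ 2) (a≡a%ℕn+[a/ℕn]*n a 2)
      (trans (a≡a%ℕn+[a/ℕn]*n b 2)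
        (cong (λ r → + r + b /ℕ 2 * + 2) (sym (%ℕ2-cong a b 2∣))))) p)
    where
    2∣ : + 2 ∣ a - b
    2∣ = ∣-trans (divides (2^ k) (ℤ.*-comm (+ 2) (2^ k))) p
    identity : ∀ a b r p q t → a ≡ r + p * t → b ≡ r + q * t →
               a - b ≡ t * (p - q)
    identity _ _ r p q t refl refl = cancel r p q t
      where
      cancel : ∀ r p q t → (r + p * t) - (r + q * t) ≡ t * (p - q)
      cancel = solve-∀

%2-cong : ∀ {m n} → m ≡ n [mod2^ 1 ] → m %2 ≡ n %2
%2-cong {m} {n} p = Fin.fromℕ<-cong _ _ (%ℕ2-cong (approx m 1) (approx n 1) p) _ _

-- Rounds down: half n is the n′ with n = (n % 2) + 2 n′.

half : ℤ₂ → ℤ₂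
approx   (half x) k = approx x (suc k) /ℕ 2
coherent (half x) k = /ℕ2-cong k (approx x (2 ℕ.+ k)) (approx x (1 ℕ.+ k)) (coherent x (suc k))

half-cong : ∀ {x y} → x ≈₂ y → half x ≈₂ half y
half-cong {x} {y} e = mk≈₂ λ k → /ℕ2-cong k (approx x (suc k)) (approx y (suc k)) (mod e (suc k))

n≈n%2+2*half[n] : ∀ n → n ≈₂ fromDigit (n %2) +₂ fromℤ (+ 2) *₂ half n
n≈n%2+2*half[n] n = mk≈₂ λ k →
  let a = approx n (suc k)
      digit : a %ℕ 2 ≡ toℕ (n %2)
      digit = trans (%ℕ2-cong a (approx n 1)
                (subst (λ i → 2^ 1 ∣ approx n i - approx n 1) (ℕ.+-comm k 1)
                  (coherent* n k 1)))
                (sym (Fin.toℕ-fromℕ< _))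
  in ∣-resp (trans (identity a (approx n k))
       (cong (λ a → approx n k - a) (trans (a≡a%ℕn+[a/ℕn]*n a 2)
         (cong₂ _+_ (cong +_ digit) (ℤ.*-comm (a /ℕ 2) (+ 2))))))
     (∣m⇒∣-m (coherent n k))
  where
  identity : ∀ a b → - (a - b) ≡ b - a
  identity = solve-∀

------------------------------------------------------------------------
-- The field ℚ₂, as the localisation of ℤ₂ at the powers of 2: the
-- element num / exp stands for num · 2^(- exp).

infix 5 _/2^_

record ℚ₂ : Set where
  no-eta-equality
  pattern
  constructor _/2^_
  field
    num : ℤ₂
    exp : ℕ

open ℚ₂ public

private
  scale : ℕ → ℤ₂
  scale e = fromℤ (2^ e)

infix 4 _≈ℚ₂_

record _≈ℚ₂_ (x y : ℚ₂) : Set where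
  constructor mk≈ℚ₂
  field
    cross : num x *₂ scale (exp y) ≈₂ num y *₂ scale (exp x)

open _≈ℚ₂_ public

toℚ₂ : ℤ₂ → ℚ₂
toℚ₂ n = n /2^ 0

ℤtoℚ₂ : ℤ → ℚ₂
ℤtoℚ₂ z = toℚ₂ (fromℤ z)

infixl 6 _+ℚ₂_
infixl 7 _*ℚ₂_
infix  8 -ℚ₂_

_+ℚ₂_ : ℚ₂ → ℚ₂ → ℚ₂
(x /2^ e) +ℚ₂ (y /2^ f) = (x *₂ scale f +₂ y *₂ scale e) /2^ (e ℕ.+ f)

_*ℚ₂_ : ℚ₂ → ℚ₂ → ℚ₂
(x /2^ e) *ℚ₂ (y /2^ f) = x *₂ y /2^ (e ℕ.+ f)

-ℚ₂_ : ℚ₂ → ℚ₂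
-ℚ₂ (x /2^ e) = -₂ x /2^ e

private
  ≈ℚ₂-pointwise : ∀ {x y} →
    (∀ k → approx (num x) k * 2^ (exp y) ≡ approx (num y) k * 2^ (exp x)) →
    x ≈ℚ₂ y
  ≈ℚ₂-pointwise e = mk≈ℚ₂ (≈₂-pointwise e)

  ≈ℚ₂-refl : ∀ {x} → x ≈ℚ₂ x
  ≈ℚ₂-refl = ≈ℚ₂-pointwise λ _ → refl

  ≈ℚ₂-sym : ∀ {x y} → x ≈ℚ₂ y → y ≈ℚ₂ x
  ≈ℚ₂-sym e = mk≈ℚ₂ (≈₂-sym (cross e))

  ≈ℚ₂-trans : ∀ {x y z} → x ≈ℚ₂ y → y ≈ℚ₂ z → x ≈ℚ₂ z
  ≈ℚ₂-trans {x /2^ e} {y /2^ f} {z /2^ g} p q =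
    mk≈ℚ₂ (2^-cancel f (mk≈₂ λ k →
      ∣-resp (identity (approx x k) (approx y k) (approx z k) (2^ e) (2^ f) (2^ g))
        (∣m∣n⇒∣m+n (∣n⇒∣m*n (2^ g) (mod (cross p) k))
                   (∣n⇒∣m*n (2^ e) (mod (cross q) k)))))
    where
    identity : ∀ x y z E F G → G * (x * F - y * E) + E * (y * G - z * F)
                             ≡ x * G * F - z * E * F
    identity = solve-∀

  ≈ℚ₂-isEquivalence : IsEquivalence _≈ℚ₂_
  ≈ℚ₂-isEquivalence = record
    { refl = ≈ℚ₂-refl ; sym = ≈ℚ₂-sym ; trans = ≈ℚ₂-trans }

  +ℚ₂-cong : ∀ {x y u v} → x ≈ℚ₂ y → u ≈ℚ₂ v → x +ℚ₂ u ≈ℚ₂ y +ℚ₂ v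
  +ℚ₂-cong {x /2^ e} {y /2^ f} {u /2^ g} {v /2^ h} p q = mk≈ℚ₂ (mk≈₂ λ k →
    ∣-resp (lemma (approx x k) (approx y k) (approx u k) (approx v k))
      (∣m∣n⇒∣m+n (∣n⇒∣m*n (2^ g * 2^ h) (mod (cross p) k))
                 (∣n⇒∣m*n (2^ e * 2^ f) (mod (cross q) k))))
    where
    identity : ∀ x y u v E F G H →
      (G * H) * (x * F - y * E) + (E * F) * (u * H - v * G)
      ≡ (x * G + u * E) * (F * H) - (y * H + v * F) * (E * G)
    identity = solve-∀
    lemma : ∀ x y u v →
      (2^ g * 2^ h) * (x * 2^ f - y * 2^ e) + (2^ e * 2^ f) * (u * 2^ h - v * 2^ g)
      ≡ (x * 2^ g + u * 2^ e) * 2^ (f ℕ.+ h) - (y * 2^ h + v * 2^ f) * 2^ (e ℕ.+ g)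
    lemma x y u v rewrite 2^-+ f h | 2^-+ e g =
      identity x y u v (2^ e) (2^ f) (2^ g) (2^ h)

  *ℚ₂-cong : ∀ {x y u v} → x ≈ℚ₂ y → u ≈ℚ₂ v → x *ℚ₂ u ≈ℚ₂ y *ℚ₂ v
  *ℚ₂-cong {x /2^ e} {y /2^ f} {u /2^ g} {v /2^ h} p q = mk≈ℚ₂ (mk≈₂ λ k →
    ∣-resp (lemma (approx x k) (approx y k) (approx u k) (approx v k))
      (∣m∣n⇒∣m+n (∣n⇒∣m*n (approx u k * 2^ h) (mod (cross p) k))
                 (∣n⇒∣m*n (approx y k * 2^ e) (mod (cross q) k))))
    where
    identity : ∀ x y u v E F G H →
      (u * H) * (x * F - y * E) + (y * E) * (u * H - v * G)
      ≡ x * u * (F * H) - y * v * (E * G)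
    identity = solve-∀
    lemma : ∀ x y u v →
      (u * 2^ h) * (x * 2^ f - y * 2^ e) + (y * 2^ e) * (u * 2^ h - v * 2^ g)
      ≡ x * u * 2^ (f ℕ.+ h) - y * v * 2^ (e ℕ.+ g)
    lemma x y u v rewrite 2^-+ f h | 2^-+ e g =
      identity x y u v (2^ e) (2^ f) (2^ g) (2^ h)

  -ℚ₂-cong : ∀ {x y} → x ≈ℚ₂ y → -ℚ₂ x ≈ℚ₂ -ℚ₂ y
  -ℚ₂-cong {x /2^ e} {y /2^ f} p = mk≈ℚ₂ (mk≈₂ λ k →
    ∣-resp (identity (approx x k) (approx y k) (2^ e) (2^ f))
      (∣m⇒∣-m (mod (cross p) k)))
    where
    identity : ∀ x y E F → - (x * F - y * E) ≡ (- x) * F - (- y) * E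
    identity = solve-∀

  +ℚ₂-assoc : ∀ x y z → (x +ℚ₂ y) +ℚ₂ z ≈ℚ₂ x +ℚ₂ (y +ℚ₂ z)
  +ℚ₂-assoc (x /2^ e) (y /2^ f) (z /2^ g) = ≈ℚ₂-pointwise λ k →
    lemma (approx x k) (approx y k) (approx z k)
    where
    identity : ∀ x y z E F G →
      ((x * F + y * E) * G + z * (E * F)) * (E * (F * G))
      ≡ (x * (F * G) + (y * G + z * F) * E) * ((E * F) * G)
    identity = solve-∀
    lemma : ∀ x y z →
      ((x * 2^ f + y * 2^ e) * 2^ g + z * 2^ (e ℕ.+ f)) * 2^ (e ℕ.+ (f ℕ.+ g))
      ≡ (x * 2^ (f ℕ.+ g) + (y * 2^ g + z * 2^ f) * 2^ e) * 2^ ((e ℕ.+ f) ℕ.+ g)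
    lemma x y z rewrite 2^-+ e (f ℕ.+ g) | 2^-+ (e ℕ.+ f) g | 2^-+ e f | 2^-+ f g =
      identity x y z (2^ e) (2^ f) (2^ g)

  +ℚ₂-comm : ∀ x y → x +ℚ₂ y ≈ℚ₂ y +ℚ₂ x
  +ℚ₂-comm (x /2^ e) (y /2^ f) = ≈ℚ₂-pointwise λ k →
    cong₂ _*_ (ℤ.+-comm (approx x k * 2^ f) (approx y k * 2^ e)) (cong 2^_ (ℕ.+-comm f e))

  +ℚ₂-identityˡ : ∀ x → ℤtoℚ₂ (+ 0) +ℚ₂ x ≈ℚ₂ x
  +ℚ₂-identityˡ (x /2^ e) = ≈ℚ₂-pointwise λ k → cong (_* 2^ e)
    (trans (ℤ.+-identityˡ (approx x k * + 1)) (ℤ.*-identityʳ (approx x k)))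

  -ℚ₂-inverseˡ : ∀ x → -ℚ₂ x +ℚ₂ x ≈ℚ₂ ℤtoℚ₂ (+ 0)
  -ℚ₂-inverseˡ (x /2^ e) = ≈ℚ₂-pointwise λ k →
    trans (cong (_* 2^ 0) (identity (approx x k) (2^ e))) refl
    where
    identity : ∀ x E → (- x) * E + x * E ≡ + 0
    identity = solve-∀

  *ℚ₂-assoc : ∀ x y z → (x *ℚ₂ y) *ℚ₂ z ≈ℚ₂ x *ℚ₂ (y *ℚ₂ z)
  *ℚ₂-assoc (x /2^ e) (y /2^ f) (z /2^ g) = ≈ℚ₂-pointwise λ k →
    cong₂ _*_ (ℤ.*-assoc (approx x k) (approx y k) (approx z k))
              (cong 2^_ (sym (ℕ.+-assoc e f g)))

  *ℚ₂-comm : ∀ x y → x *ℚ₂ y ≈ℚ₂ y *ℚ₂ x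
  *ℚ₂-comm (x /2^ e) (y /2^ f) = ≈ℚ₂-pointwise λ k →
    cong₂ _*_ (ℤ.*-comm (approx x k) (approx y k)) (cong 2^_ (ℕ.+-comm f e))

  *ℚ₂-identityˡ : ∀ x → ℤtoℚ₂ (+ 1) *ℚ₂ x ≈ℚ₂ x
  *ℚ₂-identityˡ (x /2^ e) = ≈ℚ₂-pointwise λ k →
    cong (_* 2^ e) (ℤ.*-identityˡ (approx x k))

  *ℚ₂-distribʳ : ∀ x y z → (y +ℚ₂ z) *ℚ₂ x ≈ℚ₂ y *ℚ₂ x +ℚ₂ z *ℚ₂ x
  *ℚ₂-distribʳ (x /2^ e) (y /2^ f) (z /2^ g) = ≈ℚ₂-pointwise λ k →
    lemma (approx x k) (approx y k) (approx z k)
    where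
    identity : ∀ x y z E F G →
      ((y * G + z * F) * x) * ((F * E) * (G * E))
      ≡ (y * x * (G * E) + z * x * (F * E)) * ((F * G) * E)
    identity = solve-∀
    lemma : ∀ x y z →
      ((y * 2^ g + z * 2^ f) * x) * 2^ ((f ℕ.+ e) ℕ.+ (g ℕ.+ e))
      ≡ (y * x * 2^ (g ℕ.+ e) + z * x * 2^ (f ℕ.+ e)) * 2^ ((f ℕ.+ g) ℕ.+ e)
    lemma x y z rewrite 2^-+ (f ℕ.+ e) (g ℕ.+ e) | 2^-+ (f ℕ.+ g) e
                      | 2^-+ f e | 2^-+ g e | 2^-+ f g =
      identity x y z (2^ e) (2^ f) (2^ g)

ℚ₂-commutativeRing : CommutativeRing 0ℓ 0ℓ
ℚ₂-commutativeRing = record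
  { Carrier = ℚ₂
  ; _≈_     = _≈ℚ₂_
  ; _+_     = _+ℚ₂_
  ; _*_     = _*ℚ₂_
  ; -_      = -ℚ₂_
  ; 0#      = ℤtoℚ₂ (+ 0)
  ; 1#      = ℤtoℚ₂ (+ 1)
  ; isCommutativeRing = record
    { isRing = record
      { +-isAbelianGroup = record
        { isGroup = record
          { isMonoid = record
            { isSemigroup = record
              { isMagma = record
                { isEquivalence = ≈ℚ₂-isEquivalence ; ∙-cong = +ℚ₂-cong }
              ; assoc = +ℚ₂-assoc
              }
            ; identity = +ℚ₂-identityˡ , λ x →
                ≈ℚ₂-trans (+ℚ₂-comm x (ℤtoℚ₂ (+ 0))) (+ℚ₂-identityˡ x)
            }
          ; inverse = -ℚ₂-inverseˡ , λ x →
              ≈ℚ₂-trans (+ℚ₂-comm x (-ℚ₂ x)) (-ℚ₂-inverseˡ x)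
          ; ⁻¹-cong = -ℚ₂-cong
          }
        ; comm = +ℚ₂-comm
        }
      ; *-cong = *ℚ₂-cong
      ; *-assoc = *ℚ₂-assoc
      ; *-identity = *ℚ₂-identityˡ , λ x →
          ≈ℚ₂-trans (*ℚ₂-comm x (ℤtoℚ₂ (+ 1))) (*ℚ₂-identityˡ x)
      ; distrib = (λ x y z → ≈ℚ₂-trans (*ℚ₂-comm x (y +ℚ₂ z))
                    (≈ℚ₂-trans (*ℚ₂-distribʳ x y z)
                      (+ℚ₂-cong (*ℚ₂-comm y x) (*ℚ₂-comm z x))))
                , *ℚ₂-distribʳ
      }
    ; *-comm = *ℚ₂-comm
    }
  }

module ℚ₂-Ring = CommutativeRing ℚ₂-commutativeRing

Integral : Pred ℚ₂ 0ℓ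
Integral x = ∃[ n ] toℚ₂ n ≈ℚ₂ x

-- x is the image of the fraction ↥ q / ↧ q.

Rational : Pred ℚ₂ 0ℓ
Rational x = ∃[ q ] ℤtoℚ₂ (↧ q) *ℚ₂ x ≈ℚ₂ ℤtoℚ₂ (↥ q)

ℚ∩ℤ₂ : Pred ℤ₂ 0ℓ
ℚ∩ℤ₂ = toℚ₂ ⊢ Rational

------------------------------------------------------------------------
-- 2-fibred functions

-- Func bundles a map of representatives with its compatibility with _≈₂_, so
-- it is a function on ℤ₂. Of F [ r ] only the values on r + 2ℤ₂ are used.

Fibred : Set
Fibred = Fin 2 → Func ℤ₂-setoid ℤ₂-setoid

infix 9 _[_]

_[_] : Fibred → Fin 2 → ℤ₂ → ℤ₂
F [ r ] = Func.to (F r)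

⟦_⟧ : Fibred → ℤ₂ → ℤ₂
⟦ F ⟧ n = half (F[n%2]n +₂ -₂ fromDigit (F[n%2]n %2))
  where F[n%2]n = (F [ n %2 ]) n

LinearPolynomial : Fibred → (a₀ b₀ a₁ b₁ : ℚ₂) → Set
LinearPolynomial F a₀ b₀ a₁ b₁ = Agrees zero a₀ b₀ × Agrees (suc zero) a₁ b₁
  where
  Agrees : Fin 2 → ℚ₂ → ℚ₂ → Set
  Agrees r a b = ∀ n → n %2 ≡ r → toℚ₂ ((F [ r ]) n) ≈ℚ₂ a +ℚ₂ b *ℚ₂ toℚ₂ n

WeakCanonical : Fibred → Set
WeakCanonical F = ∀ r n → n %2 ≡ r → (F [ r ]) n %2 ≡ zero

ψ : Fibred → ℤ₂ → ℕ → Fin 2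
ψ F n k = iterate ⟦ F ⟧ n k %2

Is2AdicSystem : Fibred → Set
Is2AdicSystem F = ∀ k m n →
  m ≡ n [mod2^ k ] ⇔ (∀ i → i ℕ.< k → ψ F m i ≡ ψ F n i)

record 2AdicSystem : Set where
  field
    fibred        : Fibred
    is2AdicSystem : Is2AdicSystem fibred

open 2AdicSystem public

-- A preimage of the sequence s is found digit by digit: of l and l + 2ᵏ,
-- whose expansions share their first k entries, exactly one has k-th entry s k.

module _ (F : 2AdicSystem) where

  private
    ψF = ψ (fibred F)

    module Sys k m n = Equivalence (is2AdicSystem F k m n)

    lift : (ℕ → Fin 2) → ℕ → ℤ
    lift s zero    = + 0
    lift s (suc k) with ψF (fromℤ (lift s k)) k Fin.≟ s k
    ... | yes _ = lift s k
    ... | no  _ = lift s k + 2^ k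

    shift-∣ : ∀ l k → 2^ k ∣ (l + 2^ k) - l
    shift-∣ l k = divides (+ 1) (identity l (2^ k))
      where
      identity : ∀ l p → (l + p) - l ≡ + 1 * p
      identity = solve-∀

    shift-∤ : ∀ l k → ¬ 2^ (suc k) ∣ (l + 2^ k) - l
    shift-∤ l k p = contradiction
      (*-cancelʳ-∣ (2^ k) {+ 2} {+ 1} {{2^-nonZero k}} (∣-resp (identity l (2^ k)) p))
      (from-no (+ 2 ∣? + 1))
      where
      identity : ∀ l p → (l + p) - l ≡ + 1 * p
      identity = solve-∀

    only-two : ∀ {a b c : Fin 2} → a ≢ c → b ≢ c → a ≡ b
    only-two {zero}     {zero}     _ _ = refl
    only-two {suc zero} {suc zero} _ _ = refl
    only-two {zero}     {suc zero} {zero}     a≢c _ = contradiction refl a≢c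
    only-two {zero}     {suc zero} {suc zero} _ b≢c = contradiction refl b≢c
    only-two {suc zero} {zero}     {zero}     _ b≢c = contradiction refl b≢c
    only-two {suc zero} {zero}     {suc zero} a≢c _ = contradiction refl a≢c

    lift-coherent : ∀ s k → 2^ k ∣ lift s (suc k) - lift s k
    lift-coherent s k with ψF (fromℤ (lift s k)) k Fin.≟ s k
    ... | yes _ = ∣-resp (sym (ℤ.+-inverseʳ (lift s k))) ∣0
    ... | no  _ = shift-∣ (lift s k) k

    lift-ψ : ∀ s k i → i ℕ.< k → ψF (fromℤ (lift s k)) i ≡ s i
    lift-ψ s (suc k) i i<1+k with ψF (fromℤ (lift s k)) k Fin.≟ s k
    ... | yes e with ℕ.m<1+n⇒m<n∨m≡n i<1+k
    ...   | inj₁ i<k  = lift-ψ s k i i<k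
    ...   | inj₂ refl = e
    lift-ψ s (suc k) i i<1+k | no ¬e = go i i<1+k
      where
      l = lift s k
      x = fromℤ (l + 2^ k)
      y = fromℤ l
      agree : ∀ i → i ℕ.< k → ψF x i ≡ ψF y i
      agree = Sys.to k x y (shift-∣ l k)
      go : ∀ i → i ℕ.< suc k → ψF x i ≡ s i
      go i i<1+k with ℕ.m<1+n⇒m<n∨m≡n i<1+k
      ... | inj₁ i<k  = trans (agree i i<k) (lift-ψ s k i i<k)
      ... | inj₂ refl with ψF x k Fin.≟ s k
      ...   | yes e = e
      ...   | no ¬f = contradiction (Sys.from (suc k) x y agree′) (shift-∤ l k)
        where
        agree′ : ∀ j → j ℕ.< suc k → ψF x j ≡ ψF y j
        agree′ j j<1+k with ℕ.m<1+n⇒m<n∨m≡n j<1+k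
        ... | inj₁ j<k  = agree j j<k
        ... | inj₂ refl = only-two ¬f ¬e

    limit : (ℕ → Fin 2) → ℤ₂
    limit s = mkℤ₂ (lift s) (lift-coherent s)

    limit-ψ : ∀ s k → ψF (limit s) k ≡ s k
    limit-ψ s k = trans
      (Sys.to (suc k) (limit s) (fromℤ (lift s (suc k)))
        (∣-resp (sym (ℤ.+-inverseʳ (lift s (suc k)))) ∣0) k (ℕ.n<1+n k))
      (lift-ψ s (suc k) k (ℕ.n<1+n k))

  ψ-cong : ∀ {m n} → m ≈₂ n → ψF m ≗ ψF n
  ψ-cong {m} {n} e k = Sys.to (suc k) m n (mod e (suc k)) k (ℕ.n<1+n k)

  ψ-bijective : Bijective _≈₂_ _≗_ ψF
  ψ-bijective
    = (λ {m} {n} e → mk≈₂ λ k → Sys.from k m n λ i _ → e i)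
    , (λ s → limit s , λ z≈ k → trans (ψ-cong z≈ k) (limit-ψ s k))

  ψ⁻¹ : (ℕ → Fin 2) → ℤ₂
  ψ⁻¹ s = proj₁ (proj₂ ψ-bijective s)

π : 2AdicSystem → 2AdicSystem → ℤ₂ → ℤ₂
π F G n = ψ⁻¹ G (ψ (fibred F) n)

UltimatelyPeriodic : (ℕ → Fin 2) → Set
UltimatelyPeriodic s =
  ∃[ N ] ∃[ p ] NonZero p × (∀ k → N ℕ.≤ k → s (k ℕ.+ p) ≡ s k)

infix 4 _UltimatelyPeriodicOn_

_UltimatelyPeriodicOn_ : 2AdicSystem → Pred ℤ₂ 0ℓ → Set
F UltimatelyPeriodicOn A = (ψ (fibred F) ⊢ UltimatelyPeriodic) ≐ A

image : (ℤ₂ → ℤ₂) → Pred ℤ₂ 0ℓ → Pred ℤ₂ 0ℓ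
image f A m = ∃[ n ] n ∈ A × f n ≈₂ m

{-# OPTIONS --safe #-}
module Submission where

-- The coefficients of F and G lie in ℤ₂, with b₀, b₁, a₁ odd and a₀ even, so
-- D is a unit of ℤ₂. The affine map φ of the asserted formula preserves
-- parity and satisfies φ ∘ F = G ∘ φ, whence n and φ n have the same digit
-- expansions under F and G respectively, i.e. φ = π F G. As φ has rational
-- coefficients whenever F and G do, and π G F is inverse to π F G, the
-- remaining claims follow by symmetry.

open import Defs
open import Algebra.Bundles using (CommutativeRing)
open import Algebra.Definitions _≈ℚ₂_ using (Invertible)
import Algebra.Properties.Group as GroupProperties
open import Data.Fin.Base using (Fin; zero; suc)
open import Data.Integer.Base as ℤ using (ℤ; +_; -[1+_])
open import Data.Integer.Divisibility.Signed
open import Data.Integer.GCD using (gcd)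
import Data.Integer.Properties as ℤ
open import Data.Integer.Tactic.RingSolver using (solve-∀)
open import Data.Nat.Base as ℕ using (ℕ; zero; suc; s≤s)
import Data.Nat.Coprimality as Coprime
import Data.Nat.Properties as ℕ
open import Data.Product.Base using (Σ-syntax; ∃-syntax; _×_; _,_; proj₁; proj₂)
open import Data.Rational.Base as ℚ using (mkℚ; ↥_; ↧_)
import Data.Rational.Properties as ℚ
open import Data.Sum.Base using (_⊎_; inj₁; inj₂; [_,_]′)
open import Function.Base using (id)
open import Function.Bundles using (_⇔_; mk⇔; module Equivalence)
open import Relation.Binary.Bundles using (Setoid)
open import Relation.Binary.PropositionalEquality
  using (_≡_; _≗_; refl; sym; trans; cong; subst)
import Relation.Binary.Reasoning.Setoid as SetoidReasoning
open import Relation.Nullary using (¬_; contradiction)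
open import Relation.Nullary.Decidable using (from-no)
open import Relation.Unary using (_∈_; _∩_; _≐_)
open ℚ₂-Ring using (_+_; _*_; _-_; 1#)

module ℤ₂-Ring = CommutativeRing ℤ₂-commutativeRing

≡⇒≈₂ : ∀ {x y} → x ≡ y → x ≈₂ y
≡⇒≈₂ refl = ≈₂-refl

-- Congruence modulo 2

infix 4 _~_

-- A record, because `_≡_[mod2^_]` unfolds to a divisibility between integers from which `x` and `y`
-- cannot be inferred.
record _~_ (x y : ℤ₂) : Set where
  constructor mk~
  field
    mod2 : x ≡ y [mod2^ 1 ]

~-reflexive : ∀ {x y} → x ≈₂ y → x ~ y
~-reflexive e = mk~ (mod e 1)

~-refl : ∀ {x} → x ~ x
~-refl = ~-reflexive ≈₂-refl

~-sym : ∀ {x y} → x ~ y → y ~ x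
~-sym {x} {y} (mk~ p) = mk~
  (subst (_ ∣_) (identity (approx x 1) (approx y 1)) (∣m⇒∣-m p))
  where
  identity : ∀ a b → ℤ.- (a ℤ.- b) ≡ b ℤ.- a
  identity = solve-∀

~-trans : ∀ {x y z} → x ~ y → y ~ z → x ~ z
~-trans {x} {y} {z} (mk~ p) (mk~ q) = mk~
  (subst (_ ∣_) (identity (approx x 1) (approx y 1) (approx z 1)) (∣m∣n⇒∣m+n p q))
  where
  identity : ∀ a b c → (a ℤ.- b) ℤ.+ (b ℤ.- c) ≡ a ℤ.- c
  identity = solve-∀

~-setoid : Setoid _ _
~-setoid = record
  { _≈_ = _~_
  ; isEquivalence = record { refl = ~-refl ; sym = ~-sym ; trans = ~-trans }
  }

+-cong~ : ∀ {x y u v} → x ~ y → u ~ v → x +₂ u ~ y +₂ v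
+-cong~ {x} {y} {u} {v} (mk~ p) (mk~ q) = mk~
  (subst (_ ∣_) (identity (approx x 1) (approx y 1) (approx u 1) (approx v 1))
    (∣m∣n⇒∣m+n p q))
  where
  identity : ∀ a b c d → (a ℤ.- b) ℤ.+ (c ℤ.- d) ≡ (a ℤ.+ c) ℤ.- (b ℤ.+ d)
  identity = solve-∀

*-cong~ : ∀ {x y u v} → x ~ y → u ~ v → x *₂ u ~ y *₂ v
*-cong~ {x} {y} {u} {v} (mk~ p) (mk~ q) = mk~
  (subst (_ ∣_) (identity (approx x 1) (approx y 1) (approx u 1) (approx v 1))
    (∣m∣n⇒∣m+n (∣n⇒∣m*n (approx u 1) p) (∣n⇒∣m*n (approx y 1) q)))
  where
  identity : ∀ a b c d → c ℤ.* (a ℤ.- b) ℤ.+ b ℤ.* (c ℤ.- d) ≡ a ℤ.* c ℤ.- b ℤ.* d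
  identity = solve-∀

-‿cong~ : ∀ {x y} → x ~ y → -₂ x ~ -₂ y
-‿cong~ {x} {y} (mk~ p) = mk~
  (subst (_ ∣_) (identity (approx x 1) (approx y 1)) (∣m⇒∣-m p))
  where
  identity : ∀ a b → ℤ.- (a ℤ.- b) ≡ (ℤ.- a) ℤ.- (ℤ.- b)
  identity = solve-∀

2*~0 : ∀ x → fromℤ (+ 2) *₂ x ~ fromℤ (+ 0)
2*~0 x = mk~ (divides (approx x 1) (identity (approx x 1)))
  where
  identity : ∀ a → + 2 ℤ.* a ℤ.- + 0 ≡ a ℤ.* + 2
  identity = solve-∀

~digit : ∀ n → n ~ fromDigit (n %2)
~digit n = begin
  n                                                ≈⟨ ~-reflexive (n≈n%2+2*half[n] n) ⟩
  fromDigit (n %2) +₂ fromℤ (+ 2) *₂ half n        ≈⟨ +-cong~ ~-refl (2*~0 (half n)) ⟩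
  fromDigit (n %2) +₂ fromℤ (+ 0)                  ≈⟨ ~-reflexive (ℤ₂-Ring.+-identityʳ _) ⟩
  fromDigit (n %2)                                 ∎
  where open SetoidReasoning ~-setoid

~⇒%2 : ∀ {m n} → m ~ n → m %2 ≡ n %2
~⇒%2 {m} {n} (mk~ p) = %2-cong {m} {n} p

fromDigit-%2 : ∀ r → fromDigit r %2 ≡ r
fromDigit-%2 zero       = refl
fromDigit-%2 (suc zero) = refl

-- Odd 2-adic integers as units

Odd : ℤ₂ → Set
Odd x = x ~ fromℤ (+ 1)

odd-or-even : ∀ x → Odd x ⊎ x ~ fromℤ (+ 0)
odd-or-even x with x %2 | ~digit x
... | suc zero | x~1 = inj₁ x~1
... | zero     | x~0 = inj₂ x~0

-- 1/(1 + 2h) is the fixed point of the contraction y ↦ 1 - 2hy.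

odd-inverse : ∀ {x} → Odd x → ∃[ y ] Odd y × x *₂ y ≈₂ fromℤ (+ 1)
odd-inverse {x} x-odd = y , y-odd , xy≈1
  where
  h : ℤ₂
  h = half x

  x≈1+2h : x ≈₂ fromℤ (+ 1) +₂ fromℤ (+ 2) *₂ h
  x≈1+2h = ≈₂-trans (n≈n%2+2*half[n] x)
    (+₂-cong (≡⇒≈₂ (cong fromDigit (~⇒%2 x-odd))) ≈₂-refl)

  horner : ℕ → ℤ
  horner zero    = + 0
  horner (suc k) = + 1 ℤ.- + 2 ℤ.* (approx h k ℤ.* horner k)

  horner-coherent : ∀ k → 2^ k ∣ horner (suc k) ℤ.- horner k
  horner-coherent zero    = divides (horner 1 ℤ.- horner 0)
    (sym (ℤ.*-identityʳ (horner 1 ℤ.- horner 0)))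
  -- The factor 2 in the recursion turns divisibility by 2^k into divisibility by 2^(suc k).
  horner-coherent (suc k) = subst (2^ (suc k) ∣_)
    (identity (approx h (suc k)) (approx h k) (horner (suc k)) (horner k))
    (*-monoʳ-∣ (+ 2) (∣m⇒∣-m (∣m∣n⇒∣m+n
      (∣n⇒∣m*n (horner (suc k)) (coherent h k))
      (∣n⇒∣m*n (approx h k) (horner-coherent k)))))
    where
    identity : ∀ h′ h y′ y →
      + 2 ℤ.* (ℤ.- (y′ ℤ.* (h′ ℤ.- h) ℤ.+ h ℤ.* (y′ ℤ.- y)))
      ≡ (+ 1 ℤ.- + 2 ℤ.* (h′ ℤ.* y′)) ℤ.- (+ 1 ℤ.- + 2 ℤ.* (h ℤ.* y))
    identity = solve-∀

  y : ℤ₂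
  y = mkℤ₂ horner horner-coherent

  xy≈1 : x *₂ y ≈₂ fromℤ (+ 1)
  -- With x = 1 + 2h, the difference xy - 1 at level k is minus the difference of `horner (suc k)`
  -- and `horner k`, so coherence of y is already the inverse law.
  xy≈1 = ≈₂-trans (*₂-cong x≈1+2h (≈₂-refl {y})) (mk≈₂ λ k →
    subst (2^ k ∣_) (identity (approx h k) (horner k)) (∣m⇒∣-m (horner-coherent k)))
    where
    identity : ∀ h y → ℤ.- ((+ 1 ℤ.- + 2 ℤ.* (h ℤ.* y)) ℤ.- y)
                     ≡ (+ 1 ℤ.+ + 2 ℤ.* h) ℤ.* y ℤ.- + 1
    identity = solve-∀

  y-odd : Odd y
  y-odd = begin
    y                  ≈⟨ ~-reflexive (ℤ₂-Ring.*-identityˡ y) ⟨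
    fromℤ (+ 1) *₂ y   ≈⟨ *-cong~ x-odd (~-refl {y}) ⟨
    x *₂ y             ≈⟨ ~-reflexive xy≈1 ⟩
    fromℤ (+ 1)        ∎
    where open SetoidReasoning ~-setoid

odd-cancelˡ : ∀ {x y z} → Odd x → x *₂ y ≈₂ x *₂ z → y ≈₂ z
odd-cancelˡ {x} {y} {z} x-odd e = begin
  y                  ≈⟨ undo y ⟨
  x⁻¹ *₂ (x *₂ y)    ≈⟨ *₂-cong (≈₂-refl {x⁻¹}) e ⟩
  x⁻¹ *₂ (x *₂ z)    ≈⟨ undo z ⟩
  z                  ∎
  where
  open SetoidReasoning ℤ₂-setoid
  x⁻¹ : ℤ₂
  x⁻¹ = proj₁ (odd-inverse x-odd)
  xx⁻¹≈1 : x *₂ x⁻¹ ≈₂ fromℤ (+ 1)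
  xx⁻¹≈1 = proj₂ (proj₂ (odd-inverse x-odd))
  undo : ∀ w → x⁻¹ *₂ (x *₂ w) ≈₂ w
  undo w = begin
    x⁻¹ *₂ (x *₂ w)   ≈⟨ ≈₂-pointwise (λ k → identity (approx x⁻¹ k) (approx x k) (approx w k)) ⟩
    (x *₂ x⁻¹) *₂ w   ≈⟨ *₂-cong xx⁻¹≈1 (≈₂-refl {w}) ⟩
    fromℤ (+ 1) *₂ w  ≈⟨ ℤ₂-Ring.*-identityˡ w ⟩
    w                 ∎
    where
    identity : ∀ a b c → a ℤ.* (b ℤ.* c) ≡ (b ℤ.* a) ℤ.* c
    identity = solve-∀

2*-cancel : ∀ {x y} → fromℤ (+ 2) *₂ x ≈₂ fromℤ (+ 2) *₂ y → x ≈₂ y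
2*-cancel {x} {y} e = 2^-cancel 1
  (≈₂-trans (ℤ₂-Ring.*-comm x _) (≈₂-trans e (ℤ₂-Ring.*-comm _ y)))

-- The embedding of ℤ₂ in ℚ₂

toℚ₂-cong : ∀ {x y} → x ≈₂ y → toℚ₂ x ≈ℚ₂ toℚ₂ y
toℚ₂-cong e = mk≈ℚ₂ (*₂-cong e ≈₂-refl)

toℚ₂-injective : ∀ {x y} → toℚ₂ x ≈ℚ₂ toℚ₂ y → x ≈₂ y
toℚ₂-injective e = 2^-cancel 0 (cross e)

toℚ₂-+ : ∀ x y → toℚ₂ (x +₂ y) ≈ℚ₂ toℚ₂ x + toℚ₂ y
toℚ₂-+ x y = mk≈ℚ₂ (≈₂-pointwise λ k → identity (approx x k) (approx y k))
  where
  identity : ∀ a b → (a ℤ.+ b) ℤ.* + 1 ≡ (a ℤ.* + 1 ℤ.+ b ℤ.* + 1) ℤ.* + 1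
  identity = solve-∀

toℚ₂-* : ∀ x y → toℚ₂ (x *₂ y) ≈ℚ₂ toℚ₂ x * toℚ₂ y
toℚ₂-* x y = ℚ₂-Ring.refl {toℚ₂ (x *₂ y)}

toℚ₂-- : ∀ x y → toℚ₂ (x +₂ -₂ y) ≈ℚ₂ toℚ₂ x - toℚ₂ y
toℚ₂-- x y = toℚ₂-+ x (-₂ y)

-- Rational 2-adic integers

fromℤ-* : ∀ a b → fromℤ (a ℤ.* b) ≈₂ fromℤ a *₂ fromℤ b
fromℤ-* a b = ≈₂-pointwise λ _ → refl

fromℤ-neg : ∀ a → fromℤ (ℤ.- a) ≈₂ -₂ fromℤ a
fromℤ-neg a = ≈₂-pointwise λ _ → refl

odd-neg : ∀ {x} → Odd x → Odd (-₂ x)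
odd-neg x-odd = ~-trans (-‿cong~ x-odd) (mk~ (divides (ℤ.- (+ 1)) refl))

odd-*-odd : ∀ {x y} → Odd x → Odd y → Odd (x *₂ y)
odd-*-odd x-odd y-odd = ~-trans (*-cong~ x-odd y-odd) (~-reflexive (ℤ₂-Ring.*-identityˡ _))

-- A form of membership in `ℚ∩ℤ₂` that need not be in lowest terms and allows a negative
-- denominator. Closure under the ring operations then requires no normalisation.
OddFraction : ℤ₂ → Set
OddFraction n = ∃[ d ] ∃[ u ] Odd (fromℤ d) × fromℤ d *₂ n ≈₂ fromℤ u

OddFraction-resp : ∀ {m n} → m ≈₂ n → OddFraction m → OddFraction n
OddFraction-resp m≈n (d , u , d-odd , dm≈u) =
  d , u , d-odd , ≈₂-trans (ℤ₂-Ring.*-congˡ (≈₂-sym m≈n)) dm≈u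

OddFraction-fromℤ : ∀ z → OddFraction (fromℤ z)
OddFraction-fromℤ z = + 1 , z , ~-refl , ℤ₂-Ring.*-identityˡ (fromℤ z)

OddFraction-+ : ∀ {m n} → OddFraction m → OddFraction n → OddFraction (m +₂ n)
OddFraction-+ {m} {n} (d , u , d-odd , dm≈u) (e , v , e-odd , en≈v) =
  d ℤ.* e , e ℤ.* u ℤ.+ d ℤ.* v , ~-trans (~-reflexive (fromℤ-* d e)) (odd-*-odd d-odd e-odd) , (begin
    fromℤ (d ℤ.* e) *₂ (m +₂ n)
      ≈⟨ ≈₂-pointwise (λ k → identity d e (approx m k) (approx n k)) ⟩
    fromℤ e *₂ (fromℤ d *₂ m) +₂ fromℤ d *₂ (fromℤ e *₂ n)
      ≈⟨ +₂-cong (ℤ₂-Ring.*-congˡ dm≈u) (ℤ₂-Ring.*-congˡ en≈v) ⟩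
    fromℤ e *₂ fromℤ u +₂ fromℤ d *₂ fromℤ v
      ≈⟨ ≈₂-pointwise (λ _ → refl) ⟩
    fromℤ (e ℤ.* u ℤ.+ d ℤ.* v) ∎)
  where
  open SetoidReasoning ℤ₂-setoid
  identity : ∀ d e m n → (d ℤ.* e) ℤ.* (m ℤ.+ n) ≡ e ℤ.* (d ℤ.* m) ℤ.+ d ℤ.* (e ℤ.* n)
  identity = solve-∀

OddFraction-* : ∀ {m n} → OddFraction m → OddFraction n → OddFraction (m *₂ n)
OddFraction-* {m} {n} (d , u , d-odd , dm≈u) (e , v , e-odd , en≈v) =
  d ℤ.* e , u ℤ.* v , ~-trans (~-reflexive (fromℤ-* d e)) (odd-*-odd d-odd e-odd) , (begin
    fromℤ (d ℤ.* e) *₂ (m *₂ n)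
      ≈⟨ ≈₂-pointwise (λ k → identity d e (approx m k) (approx n k)) ⟩
    (fromℤ d *₂ m) *₂ (fromℤ e *₂ n)
      ≈⟨ *₂-cong dm≈u en≈v ⟩
    fromℤ u *₂ fromℤ v
      ≈⟨ ≈₂-pointwise (λ _ → refl) ⟩
    fromℤ (u ℤ.* v) ∎)
  where
  open SetoidReasoning ℤ₂-setoid
  identity : ∀ d e m n → (d ℤ.* e) ℤ.* (m ℤ.* n) ≡ (d ℤ.* m) ℤ.* (e ℤ.* n)
  identity = solve-∀

OddFraction-neg : ∀ {n} → OddFraction n → OddFraction (-₂ n)
OddFraction-neg {n} p = OddFraction-resp
  (≈₂-pointwise λ k → identity (approx n k))
  (OddFraction-* (OddFraction-fromℤ (ℤ.- (+ 1))) p)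
  where
  identity : ∀ a → ℤ.- (+ 1) ℤ.* a ≡ ℤ.- a
  identity = solve-∀

OddFraction-- : ∀ {m n} → OddFraction m → OddFraction n → OddFraction (m +₂ -₂ n)
OddFraction-- p q = OddFraction-+ p (OddFraction-neg q)

-- If m = u/d then 1/m = d/u, and this is again an admissible fraction because u = dm is a product
-- of odd numbers.
OddFraction-inverse : ∀ {m n} → Odd m → m *₂ n ≈₂ fromℤ (+ 1) →
                      OddFraction m → OddFraction n
OddFraction-inverse {m} {n} m-odd mn≈1 (d , u , d-odd , dm≈u) = u , d , u-odd , un≈d
  where
  u-odd : Odd (fromℤ u)
  u-odd = ~-trans (~-reflexive (≈₂-sym dm≈u)) (odd-*-odd d-odd m-odd)

  open SetoidReasoning ℤ₂-setoid
  un≈d : fromℤ u *₂ n ≈₂ fromℤ d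
  un≈d = begin
    fromℤ u *₂ n          ≈⟨ ℤ₂-Ring.*-congʳ dm≈u ⟨
    fromℤ d *₂ m *₂ n     ≈⟨ ℤ₂-Ring.*-assoc (fromℤ d) m n ⟩
    fromℤ d *₂ (m *₂ n)   ≈⟨ ℤ₂-Ring.*-congˡ mn≈1 ⟩
    fromℤ d *₂ fromℤ (+ 1) ≈⟨ ℤ₂-Ring.*-identityʳ (fromℤ d) ⟩
    fromℤ d               ∎

Rational-resp : ∀ {x y} → x ≈ℚ₂ y → Rational x → Rational y
Rational-resp x≈y (q , e) =
  q , ℚ₂-Ring.trans (ℚ₂-Ring.*-congˡ (ℚ₂-Ring.sym x≈y)) e

even⇒2∣ : ∀ {z} → fromℤ z ~ fromℤ (+ 0) → + 2 ∣ z
even⇒2∣ {z} (mk~ p) = subst (+ 2 ∣_) (ℤ.+-identityʳ z) p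

-- If ↧ q were even then ↥ q = ↧ q · n would be even too.

denominator-odd : ∀ q n → fromℤ (↧ q) *₂ n ≈₂ fromℤ (↥ q) → Odd (fromℤ (↧ q))
denominator-odd q@(mkℚ u d-1 coprime) n e
  with fromℤ (↧ q) %2 | ~digit (fromℤ (↧ q))
... | suc zero | d~1 = d~1
... | zero     | d~0 = contradiction (Coprime.recompute coprime (∣⇒∣ᵤ 2∣u , ∣⇒∣ᵤ (even⇒2∣ d~0))) λ ()
  where
  2∣u : + 2 ∣ u
  2∣u = even⇒2∣ (begin
    fromℤ u            ≈⟨ ~-reflexive e ⟨
    fromℤ (↧ q) *₂ n   ≈⟨ *-cong~ d~0 ~-refl ⟩
    fromℤ (+ 0) *₂ n   ≈⟨ ~-reflexive (ℤ₂-Ring.zeroˡ n) ⟩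
    fromℤ (+ 0)        ∎)
    where open SetoidReasoning ~-setoid

odd-factorʳ : ∀ x y → Odd (x *₂ y) → Odd y
odd-factorʳ x y xy-odd with y %2 | ~digit y
... | suc zero | y~1 = y~1
... | zero     | y~0 = contradiction (~⇒%2 0~1) λ ()
  where
  0~1 : fromℤ (+ 0) ~ fromℤ (+ 1)
  0~1 = begin
    fromℤ (+ 0)        ≈⟨ ~-reflexive (ℤ₂-Ring.zeroʳ x) ⟨
    x *₂ fromℤ (+ 0)   ≈⟨ *-cong~ (~-refl {x}) y~0 ⟨
    x *₂ y             ≈⟨ xy-odd ⟩
    fromℤ (+ 1)        ∎
    where open SetoidReasoning ~-setoid

ℚ∩ℤ₂⇒OddFraction : ∀ {n} → n ∈ ℚ∩ℤ₂ → OddFraction n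
ℚ∩ℤ₂⇒OddFraction {n} (q , e) =
  ↧ q , ↥ q , denominator-odd q n (toℚ₂-injective e) , toℚ₂-injective e

-- Here `g` stands for the common factor removed when u/m is reduced to `q`. As a factor of the odd
-- `m` it is odd, hence a unit of `ℤ₂`, and cancels from mn = u.
reduced-fraction∈ℚ∩ℤ₂ : ∀ {n} q g {m u} → ↧ q ℤ.* g ≡ m → ↥ q ℤ.* g ≡ u →
                        Odd (fromℤ m) → fromℤ m *₂ n ≈₂ fromℤ u → n ∈ ℚ∩ℤ₂
reduced-fraction∈ℚ∩ℤ₂ {n} q g refl refl m-odd mn≈u =
  q , toℚ₂-cong (odd-cancelˡ g-odd (begin
    fromℤ g *₂ (fromℤ (↧ q) *₂ n)   ≈⟨ ≈₂-pointwise (λ k → identity g (↧ q) (approx n k)) ⟩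
    fromℤ (↧ q ℤ.* g) *₂ n          ≈⟨ mn≈u ⟩
    fromℤ (↥ q ℤ.* g)               ≈⟨ ≈₂-pointwise (λ _ → ℤ.*-comm (↥ q) g) ⟩
    fromℤ g *₂ fromℤ (↥ q)          ∎))
  where
  open SetoidReasoning ℤ₂-setoid
  g-odd : Odd (fromℤ g)
  g-odd = odd-factorʳ (fromℤ (↧ q)) (fromℤ g)
    (~-trans (~-reflexive (≈₂-sym (fromℤ-* (↧ q) g))) m-odd)
  identity : ∀ g d n → g ℤ.* (d ℤ.* n) ≡ (d ℤ.* g) ℤ.* n
  identity = solve-∀

odd-quotient∈ℚ∩ℤ₂ : ∀ {n} m u .{{_ : ℕ.NonZero m}} → Odd (fromℤ (+ m)) →
                    fromℤ (+ m) *₂ n ≈₂ fromℤ u → n ∈ ℚ∩ℤ₂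
odd-quotient∈ℚ∩ℤ₂ m u =
  reduced-fraction∈ℚ∩ℤ₂ (u ℚ./ m) (gcd u (+ m)) (ℚ.↧-/ u m) (ℚ.↥-/ u m)

-- Denominators in `ℚ` are positive, so a negative denominator hands its sign to the numerator,
-- while the denominator 0 is excluded by oddness.
OddFraction⇒ℚ∩ℤ₂ : ∀ {n} → OddFraction n → n ∈ ℚ∩ℤ₂
OddFraction⇒ℚ∩ℤ₂ (+ zero , u , d-odd , dn≈u) = contradiction (~⇒%2 d-odd) λ ()
OddFraction⇒ℚ∩ℤ₂ (+ suc m , u , d-odd , dn≈u) = odd-quotient∈ℚ∩ℤ₂ (suc m) u d-odd dn≈u
OddFraction⇒ℚ∩ℤ₂ {n} (-[1+ m ] , u , d-odd , dn≈u) =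
  odd-quotient∈ℚ∩ℤ₂ (suc m) (ℤ.- u) -d-odd (begin
    fromℤ (+ suc m) *₂ n        ≈⟨ ≈₂-pointwise (λ k → sym (ℤ.neg-distribˡ-* -[1+ m ] (approx n k))) ⟩
    -₂ (fromℤ -[1+ m ] *₂ n)    ≈⟨ -₂-cong dn≈u ⟩
    -₂ fromℤ u                  ≈⟨ ≈₂-pointwise (λ _ → refl) ⟩
    fromℤ (ℤ.- u)               ∎)
  where
  open SetoidReasoning ℤ₂-setoid
  -d-odd : Odd (fromℤ (+ suc m))
  -d-odd = ~-trans (~-reflexive (fromℤ-neg -[1+ m ])) (odd-neg d-odd)

Rational-toℚ₂⇒OddFraction : ∀ {x n} → x ≈ℚ₂ toℚ₂ n → Rational x → OddFraction n
Rational-toℚ₂⇒OddFraction x≈n x-rational = ℚ∩ℤ₂⇒OddFraction (Rational-resp x≈n x-rational)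

-- Linear-polynomial systems in weak canonical form

-- The integral form of a linear-polynomial system in weak canonical form. The equation is for twice
-- the value, so that it is free of division by 2 and lives in `ℤ₂`.
record Affine (F : 2AdicSystem) (α β : Fin 2 → ℤ₂) : Set where
  field
    α-digit : ∀ r → α r ~ fromDigit r
    β-odd   : ∀ r → Odd (β r)
    double  : ∀ n → fromℤ (+ 2) *₂ ⟦ fibred F ⟧ n ≈₂ α (n %2) +₂ β (n %2) *₂ n

-- The slopes of `F` and `G` are extracted separately and agree only up to `_≈₂_`; this lets both
-- systems be described with one `β`.
Affine-resp-β : ∀ {F α β γ} → (∀ r → γ r ≈₂ β r) → Affine F α β → Affine F α γ
Affine-resp-β {γ = γ} γ≈β F-affine = record
  { α-digit = α-digit
  ; β-odd   = λ r → ~-trans (~-reflexive (γ≈β r)) (β-odd r)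
  ; double  = λ n → ≈₂-trans (double n)
      (ℤ₂-Ring.+-congˡ (ℤ₂-Ring.*-congʳ (≈₂-sym (γ≈β (n %2)))))
  }
  where open Affine F-affine

-- In weak canonical form the digit subtracted before halving is 0 and the halved number is even, so
-- doubling undoes `half` exactly.
2*⟦F⟧≈F[r] : ∀ {F} → WeakCanonical F → ∀ r n → n %2 ≡ r →
                       fromℤ (+ 2) *₂ ⟦ F ⟧ n ≈₂ (F [ r ]) n
2*⟦F⟧≈F[r] {F} F-canonical r n refl = begin
  fromℤ (+ 2) *₂ half m         ≈⟨ ℤ₂-Ring.+-identityˡ _ ⟨
  fromℤ (+ 0) +₂ fromℤ (+ 2) *₂ half m
    ≡⟨ cong (λ s → fromDigit s +₂ fromℤ (+ 2) *₂ half m) m%2≡0 ⟨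
  fromDigit (m %2) +₂ fromℤ (+ 2) *₂ half m  ≈⟨ n≈n%2+2*half[n] m ⟨
  m                             ≈⟨ m≈Fn ⟩
  (F [ n %2 ]) n                ∎
  where
  open SetoidReasoning ℤ₂-setoid
  Fn = (F [ n %2 ]) n
  m  = Fn +₂ -₂ fromDigit (Fn %2)
  m≈Fn : m ≈₂ Fn
  m≈Fn = ≈₂-trans
    (ℤ₂-Ring.+-congˡ (-₂-cong (≡⇒≈₂ (cong fromDigit (F-canonical (n %2) n refl)))))
    (≈₂-pointwise λ k → ℤ.+-identityʳ (approx Fn k))
  m%2≡0 : m %2 ≡ zero
  m%2≡0 = trans (~⇒%2 (~-reflexive m≈Fn)) (F-canonical (n %2) n refl)

-- The slope is (2v - 2u) / ((n + 2) - n) = v - u: the distance 2 of the two arguments cancels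
-- against the doubling of the values, which makes the slope integral.
difference-quotient : ∀ a b n u v →
  toℚ₂ (fromℤ (+ 2) *₂ u) ≈ℚ₂ a + b * toℚ₂ n →
  toℚ₂ (fromℤ (+ 2) *₂ v) ≈ℚ₂ a + b * toℚ₂ (n +₂ fromℤ (+ 2)) →
  b ≈ℚ₂ toℚ₂ (v +₂ -₂ u)
difference-quotient (x /2^ e) (y /2^ g) n u v p q = ℚ₂-Ring.sym
  {toℚ₂ (v +₂ -₂ u)} {y /2^ g} (mk≈ℚ₂ (2^-cancel (suc e) (begin
    -- Multiplying by 2^(suc e) clears the denominator 2^e of the intercept and supplies the 2 of
    -- the doubled values; what results is the difference of the two cross-multiplied hypotheses.
    (v +₂ -₂ u) *₂ fromℤ (2^ g) *₂ fromℤ (2^ (suc e))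
      ≈⟨ ≈₂-pointwise (λ k → clear (approx u k) (approx v k)) ⟩
    value v +₂ -₂ value u
      ≈⟨ +₂-cong (cross q) (-₂-cong (cross p)) ⟩
    linear (n +₂ fromℤ (+ 2)) +₂ -₂ linear n
      ≈⟨ ≈₂-pointwise (λ k → difference (approx x k) (approx y k) (approx n k) (2^ e) (2^ (g ℕ.+ 0))) ⟩
    y *₂ fromℤ (2^ 0) *₂ fromℤ (2^ (suc e)) ∎)))
  where
  open SetoidReasoning ℤ₂-setoid
  value linear : ℤ₂ → ℤ₂
  value w  = fromℤ (+ 2) *₂ w *₂ fromℤ (2^ (e ℕ.+ (g ℕ.+ 0)))
  linear m = (x *₂ fromℤ (2^ (g ℕ.+ 0)) +₂ y *₂ m *₂ fromℤ (2^ e)) *₂ fromℤ (2^ 0)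
  clear : ∀ u v → (v ℤ.+ ℤ.- u) ℤ.* 2^ g ℤ.* 2^ (suc e)
                ≡ (+ 2 ℤ.* v ℤ.* 2^ (e ℕ.+ (g ℕ.+ 0))) ℤ.+ ℤ.- (+ 2 ℤ.* u ℤ.* 2^ (e ℕ.+ (g ℕ.+ 0)))
  clear u v rewrite 2^-+ e (g ℕ.+ 0) | ℕ.+-identityʳ g = identity u v (2^ e) (2^ g)
    where
    identity : ∀ u v E G → (v ℤ.+ ℤ.- u) ℤ.* G ℤ.* (+ 2 ℤ.* E)
                         ≡ (+ 2 ℤ.* v ℤ.* (E ℤ.* G)) ℤ.+ ℤ.- (+ 2 ℤ.* u ℤ.* (E ℤ.* G))
    identity = solve-∀
  difference : ∀ x y n E G →
    (x ℤ.* G ℤ.+ y ℤ.* (n ℤ.+ + 2) ℤ.* E) ℤ.* + 1 ℤ.+ ℤ.- ((x ℤ.* G ℤ.+ y ℤ.* n ℤ.* E) ℤ.* + 1)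
    ≡ y ℤ.* + 1 ℤ.* (+ 2 ℤ.* E)
  difference = solve-∀

-- The values of ⟦ F ⟧ at r and r + 2 show that the coefficients are integral;
-- r and r + 2 differ modulo 4, so these values have distinct parities, and
-- their difference, the slope, is odd.

module _ (F : 2AdicSystem) (F-canonical : WeakCanonical (fibred F))
         (a b : Fin 2 → ℚ₂)
         (F-linear : ∀ r n → n %2 ≡ r →
                     toℚ₂ ((fibred F [ r ]) n) ≈ℚ₂ a r + b r * toℚ₂ n) where

  private
    f : ℤ₂ → ℤ₂
    f = ⟦ fibred F ⟧

    r+2 : Fin 2 → ℤ₂
    r+2 r = fromDigit r +₂ fromℤ (+ 2)

    r+2%2 : ∀ r → r+2 r %2 ≡ r
    r+2%2 zero       = refl
    r+2%2 (suc zero) = refl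

    values : ∀ r n → n %2 ≡ r → toℚ₂ (fromℤ (+ 2) *₂ f n) ≈ℚ₂ a r + b r * toℚ₂ n
    values r n n%2≡r = ℚ₂-Ring.trans
      (toℚ₂-cong (2*⟦F⟧≈F[r] {fibred F} F-canonical r n n%2≡r)) (F-linear r n n%2≡r)

    β α : Fin 2 → ℤ₂
    β r = f (r+2 r) +₂ -₂ f (fromDigit r)
    α r = fromℤ (+ 2) *₂ f (fromDigit r) +₂ -₂ (β r *₂ fromDigit r)

  slope≈β : ∀ r → b r ≈ℚ₂ toℚ₂ (β r)
  slope≈β r = difference-quotient (a r) (b r) (fromDigit r) (f (fromDigit r)) (f (r+2 r))
    (values r (fromDigit r) (fromDigit-%2 r)) (values r (r+2 r) (r+2%2 r))

  intercept≈α : ∀ r → a r ≈ℚ₂ toℚ₂ (α r)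
  intercept≈α r = begin
    a r
      ≈⟨ x≈z//y (a r) (b r * toℚ₂ (fromDigit r)) _ (ℚ₂-Ring.sym (values r (fromDigit r) (fromDigit-%2 r))) ⟩
    toℚ₂ (fromℤ (+ 2) *₂ f (fromDigit r)) - b r * toℚ₂ (fromDigit r)
      ≈⟨ ℚ₂-Ring.+-congˡ (ℚ₂-Ring.-‿cong (ℚ₂-Ring.*-congʳ (slope≈β r))) ⟩
    toℚ₂ (fromℤ (+ 2) *₂ f (fromDigit r)) - toℚ₂ (β r *₂ fromDigit r)
      ≈⟨ toℚ₂-- _ (β r *₂ fromDigit r) ⟨
    toℚ₂ (α r) ∎
    where
    open SetoidReasoning ℚ₂-Ring.setoid
    open GroupProperties ℚ₂-Ring.+-group using (x≈z//y)

  slope-odd : ∀ r → Odd (β r)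
  slope-odd r = [ id , (λ β~0 → contradiction
    (Equivalence.from (is2AdicSystem F 2 (r+2 r) (fromDigit r)) (same-digits β~0)) (4∤2 r)) ]′
    (odd-or-even (β r))
    where
    f~f : β r ~ fromℤ (+ 0) → f (r+2 r) ~ f (fromDigit r)
    f~f β~0 = begin
      f (r+2 r)                    ≈⟨ ~-reflexive (≈₂-pointwise λ k → identity (approx (f (r+2 r)) k) (approx (f (fromDigit r)) k)) ⟩
      β r +₂ f (fromDigit r)       ≈⟨ +-cong~ β~0 ~-refl ⟩
      fromℤ (+ 0) +₂ f (fromDigit r) ≈⟨ ~-reflexive (ℤ₂-Ring.+-identityˡ _) ⟩
      f (fromDigit r)              ∎
      where
      open SetoidReasoning ~-setoid
      identity : ∀ a b → a ≡ (a ℤ.+ ℤ.- b) ℤ.+ b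
      identity = solve-∀
    same-digits : β r ~ fromℤ (+ 0) → ∀ i → i ℕ.< 2 → ψ (fibred F) (r+2 r) i ≡ ψ (fibred F) (fromDigit r) i
    same-digits _   zero          _ = trans (r+2%2 r) (sym (fromDigit-%2 r))
    same-digits β~0 (suc zero)    _ = ~⇒%2 (f~f β~0)
    same-digits _   (suc (suc _)) (s≤s (s≤s ()))
    4∤2 : ∀ r → ¬ (r+2 r ≡ fromDigit r [mod2^ 2 ])
    4∤2 zero       = from-no (+ 4 ∣? + 2)
    4∤2 (suc zero) = from-no (+ 4 ∣? + 2)

  -- In α r = 2 f(r) - β r * r the first term vanishes modulo 2 and β r is odd, which leaves -r, and
  -- -r is congruent to r.
  α~digit : ∀ r → α r ~ fromDigit r
  α~digit r = begin
    α r
      ≈⟨ +-cong~ (2*~0 (f (fromDigit r))) (-‿cong~ (*-cong~ (slope-odd r) ~-refl)) ⟩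
    fromℤ (+ 0) +₂ -₂ (fromℤ (+ 1) *₂ fromDigit r)
      ≈⟨ negate r ⟩
    fromDigit r ∎
    where
    open SetoidReasoning ~-setoid
    negate : ∀ r → fromℤ (+ 0) +₂ -₂ (fromℤ (+ 1) *₂ fromDigit r) ~ fromDigit r
    negate zero       = mk~ (divides (+ 0) refl)
    negate (suc zero) = mk~ (divides (ℤ.- (+ 1)) refl)

  affine-coefficients : ∃[ α ] ∃[ β ] Affine F α β
    × (∀ r → a r ≈ℚ₂ toℚ₂ (α r)) × (∀ r → b r ≈ℚ₂ toℚ₂ (β r))
  affine-coefficients = α , β , F-affine , intercept≈α , slope≈β
    where
    F-affine : Affine F α β
    F-affine = record
      { α-digit = α~digit
      ; β-odd   = slope-odd
      ; double  = λ n → toℚ₂-injective (begin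
          toℚ₂ (fromℤ (+ 2) *₂ f n)
            ≈⟨ values (n %2) n refl ⟩
          a (n %2) + b (n %2) * toℚ₂ n
            ≈⟨ ℚ₂-Ring.+-cong (intercept≈α (n %2)) (ℚ₂-Ring.*-congʳ (slope≈β (n %2))) ⟩
          toℚ₂ (α (n %2)) + toℚ₂ (β (n %2) *₂ n)
            ≈⟨ toℚ₂-+ (α (n %2)) (β (n %2) *₂ n) ⟨
          toℚ₂ (α (n %2) +₂ β (n %2) *₂ n) ∎)
      }
      where open SetoidReasoning ℚ₂-Ring.setoid

-- Changing the constant coefficients

-- The determinant of the 2 by 2 matrix with rows (β r - 2, α r). It gives the denominator D of the
-- formula for the constants of `F`, and the coefficient of n in the numerator for those of `G`.
determinant : (α β : Fin 2 → ℤ₂) → ℤ₂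
determinant α β =
  (β zero +₂ -₂ fromℤ (+ 2)) *₂ α (suc zero) +₂ -₂ ((β (suc zero) +₂ -₂ fromℤ (+ 2)) *₂ α zero)

-- Modulo 2 the expression becomes (1 - 2) * 1 - (1 - 2) * 0 = -1.
determinant-odd : ∀ {F α β} → Affine F α β → Odd (determinant α β)
determinant-odd {α = α} {β} F-affine = ~-trans
  (+-cong~ (product zero (suc zero)) (-‿cong~ (product (suc zero) zero)))
  (mk~ (divides (ℤ.- (+ 1)) refl))
  where
  open Affine F-affine
  product : ∀ r s → (β r +₂ -₂ fromℤ (+ 2)) *₂ α s
                  ~ (fromℤ (+ 1) +₂ -₂ fromℤ (+ 2)) *₂ fromDigit s
  product r s = *-cong~ (+-cong~ (β-odd r) ~-refl) (α-digit s)

module _ {F G : 2AdicSystem} {α′ α″ β : Fin 2 → ℤ₂}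
         (F-affine : Affine F α′ β) (G-affine : Affine G α″ β)
         {δ⁻¹ : ℤ₂} (δ⁻¹-odd : Odd δ⁻¹) (δδ⁻¹≈1 : determinant α′ β *₂ δ⁻¹ ≈₂ fromℤ (+ 1)) where

  private
    module F = Affine F-affine
    module G = Affine G-affine

    f g : ℤ₂ → ℤ₂
    f = ⟦ fibred F ⟧
    g = ⟦ fibred G ⟧

    δ A B : ℤ₂
    δ = determinant α′ β
    A = α′ zero *₂ α″ (suc zero) +₂ -₂ (α′ (suc zero) *₂ α″ zero)
    B = determinant α″ β

  -- The branch n ↦ (α′ r + β r * n) / 2 of `F` has the fixed point -α′ r / (β r - 2), where β r is
  -- not 2 because it is odd. This is the affine map that carries the fixed points of the two
  -- branches of `F` to those of the corresponding branches of `G`.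
  conjugacy : ℤ₂ → ℤ₂
  conjugacy n = (A +₂ n *₂ B) *₂ δ⁻¹

  -- The constant term `A` is 0 * 1 - 1 * 0 = 0 modulo 2, while `B` and `δ⁻¹` are odd.
  conjugacy-~ : ∀ n → conjugacy n ~ n
  conjugacy-~ n = begin
    (A +₂ n *₂ B) *₂ δ⁻¹
      ≈⟨ *-cong~ (+-cong~ A~0 (*-cong~ (~-refl {n}) (determinant-odd G-affine))) δ⁻¹-odd ⟩
    (fromℤ (+ 0) +₂ n *₂ fromℤ (+ 1)) *₂ fromℤ (+ 1)
      ≈⟨ ~-reflexive (≈₂-pointwise λ k → identity (approx n k)) ⟩
    n ∎
    where
    open SetoidReasoning ~-setoid
    A~0 : A ~ fromℤ (+ 0)
    A~0 = ~-trans
      (+-cong~ (*-cong~ (F.α-digit zero) (G.α-digit (suc zero)))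
               (-‿cong~ (*-cong~ (F.α-digit (suc zero)) (G.α-digit zero))))
      (mk~ (divides (+ 0) refl))
    identity : ∀ a → (+ 0 ℤ.+ a ℤ.* + 1) ℤ.* + 1 ≡ a
    identity = solve-∀

  -- The constant terms of the conjugation identity on branch r, multiplied by 2 `δ`. The terms
  -- linear in n are β r * n * B on both sides, because `F` and `G` have the same slopes.
  intertwining : ∀ r → α″ r *₂ δ +₂ β r *₂ A ≈₂ fromℤ (+ 2) *₂ A +₂ α′ r *₂ B
  intertwining zero = ≈₂-pointwise λ k → identity (approx (α′ zero) k) (approx (α′ (suc zero)) k) (approx (α″ zero) k)
      (approx (α″ (suc zero)) k) (approx (β zero) k) (approx (β (suc zero)) k)
    where
    identity : ∀ a₀ a₁ c₀ c₁ b₀ b₁ →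
      c₀ ℤ.* ((b₀ ℤ.+ ℤ.- (+ 2)) ℤ.* a₁ ℤ.+ ℤ.- ((b₁ ℤ.+ ℤ.- (+ 2)) ℤ.* a₀))
        ℤ.+ b₀ ℤ.* (a₀ ℤ.* c₁ ℤ.+ ℤ.- (a₁ ℤ.* c₀))
      ≡ + 2 ℤ.* (a₀ ℤ.* c₁ ℤ.+ ℤ.- (a₁ ℤ.* c₀))
        ℤ.+ a₀ ℤ.* ((b₀ ℤ.+ ℤ.- (+ 2)) ℤ.* c₁ ℤ.+ ℤ.- ((b₁ ℤ.+ ℤ.- (+ 2)) ℤ.* c₀))
    identity = solve-∀
  intertwining (suc zero) = ≈₂-pointwise λ k → identity (approx (α′ zero) k) (approx (α′ (suc zero)) k) (approx (α″ zero) k)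
      (approx (α″ (suc zero)) k) (approx (β zero) k) (approx (β (suc zero)) k)
    where
    identity : ∀ a₀ a₁ c₀ c₁ b₀ b₁ →
      c₁ ℤ.* ((b₀ ℤ.+ ℤ.- (+ 2)) ℤ.* a₁ ℤ.+ ℤ.- ((b₁ ℤ.+ ℤ.- (+ 2)) ℤ.* a₀))
        ℤ.+ b₁ ℤ.* (a₀ ℤ.* c₁ ℤ.+ ℤ.- (a₁ ℤ.* c₀))
      ≡ + 2 ℤ.* (a₀ ℤ.* c₁ ℤ.+ ℤ.- (a₁ ℤ.* c₀))
        ℤ.+ a₁ ℤ.* ((b₀ ℤ.+ ℤ.- (+ 2)) ℤ.* c₁ ℤ.+ ℤ.- ((b₁ ℤ.+ ℤ.- (+ 2)) ℤ.* c₀))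
    identity = solve-∀

  conjugacy-step : ∀ n → g (conjugacy n) ≈₂ conjugacy (f n)
  conjugacy-step n = 2*-cancel (begin
    fromℤ (+ 2) *₂ g (conjugacy n)
      ≈⟨ G.double (conjugacy n) ⟩
    α″ (conjugacy n %2) +₂ β (conjugacy n %2) *₂ conjugacy n
      -- Preservation of parity makes `G` use at `conjugacy n` the branch that `F` uses at n.
      ≡⟨ cong (λ s → α″ s +₂ β s *₂ conjugacy n) (~⇒%2 (conjugacy-~ n)) ⟩
    α″ r +₂ β r *₂ conjugacy n
      ≈⟨ +₂-cong (ℤ₂-Ring.*-identityʳ (α″ r)) ≈₂-refl ⟨
    α″ r *₂ fromℤ (+ 1) +₂ β r *₂ conjugacy n
      -- The factor 1 is written as δ * δ⁻¹, so that `δ⁻¹` can be pulled out of the whole sum.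
      ≈⟨ +₂-cong (*₂-cong (≈₂-refl {α″ r}) δδ⁻¹≈1) ≈₂-refl ⟨
    α″ r *₂ (δ *₂ δ⁻¹) +₂ β r *₂ conjugacy n
      ≈⟨ ≈₂-pointwise (λ k → collect (approx (α″ r) k) (approx δ k) (approx δ⁻¹ k) (approx (β r) k) (approx A k) (approx n k) (approx B k)) ⟩
    (α″ r *₂ δ +₂ β r *₂ A +₂ β r *₂ n *₂ B) *₂ δ⁻¹
      ≈⟨ *₂-cong (+₂-cong (intertwining r) ≈₂-refl) ≈₂-refl ⟩
    (fromℤ (+ 2) *₂ A +₂ α′ r *₂ B +₂ β r *₂ n *₂ B) *₂ δ⁻¹
      ≈⟨ ≈₂-pointwise (λ k → regroup (approx A k) (approx (α′ r) k) (approx B k) (approx (β r) k) (approx n k) (approx δ⁻¹ k)) ⟩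
    (fromℤ (+ 2) *₂ A +₂ (α′ r +₂ β r *₂ n) *₂ B) *₂ δ⁻¹
      ≈⟨ *₂-cong (+₂-cong ≈₂-refl (*₂-cong (F.double n) (≈₂-refl {B}))) ≈₂-refl ⟨
    (fromℤ (+ 2) *₂ A +₂ fromℤ (+ 2) *₂ f n *₂ B) *₂ δ⁻¹
      ≈⟨ ≈₂-pointwise (λ k → factor (approx A k) (approx (f n) k) (approx B k) (approx δ⁻¹ k)) ⟩
    fromℤ (+ 2) *₂ conjugacy (f n) ∎)
    where
    open SetoidReasoning ℤ₂-setoid
    r = n %2
    collect : ∀ c d i b A n B →
      c ℤ.* (d ℤ.* i) ℤ.+ b ℤ.* ((A ℤ.+ n ℤ.* B) ℤ.* i)
      ≡ (c ℤ.* d ℤ.+ b ℤ.* A ℤ.+ b ℤ.* n ℤ.* B) ℤ.* i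
    collect = solve-∀
    regroup : ∀ A a B b n i →
      (+ 2 ℤ.* A ℤ.+ a ℤ.* B ℤ.+ b ℤ.* n ℤ.* B) ℤ.* i
      ≡ (+ 2 ℤ.* A ℤ.+ (a ℤ.+ b ℤ.* n) ℤ.* B) ℤ.* i
    regroup = solve-∀
    factor : ∀ A n B i →
      (+ 2 ℤ.* A ℤ.+ + 2 ℤ.* n ℤ.* B) ℤ.* i ≡ + 2 ℤ.* ((A ℤ.+ n ℤ.* B) ℤ.* i)
    factor = solve-∀

  -- Induction on the index, for all n at once: equal parity settles the first digit, and the later
  -- digits of n are the digits of f n, to which the conjugation applies.
  ψ-conjugacy : ∀ n → ψ (fibred G) (conjugacy n) ≗ ψ (fibred F) n
  ψ-conjugacy n zero    = ~⇒%2 (conjugacy-~ n)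
  ψ-conjugacy n (suc k) = trans (ψ-cong G (conjugacy-step n) k) (ψ-conjugacy (f n) k)

  conjugacy-OddFraction : (∀ r → OddFraction (α′ r)) → (∀ r → OddFraction (α″ r)) →
    (∀ r → OddFraction (β r)) → ∀ {n} → OddFraction n → OddFraction (conjugacy n)
  conjugacy-OddFraction α′-rational α″-rational β-rational n-rational =
    OddFraction-*
      (OddFraction-+
        (OddFraction-- (OddFraction-* (α′-rational zero) (α″-rational (suc zero)))
                       (OddFraction-* (α′-rational (suc zero)) (α″-rational zero)))
        (OddFraction-* n-rational (determinant-OddFraction α″-rational)))
      (OddFraction-inverse (determinant-odd F-affine) δδ⁻¹≈1 (determinant-OddFraction α′-rational))
    where
    determinant-OddFraction : ∀ {α} → (∀ r → OddFraction (α r)) → OddFraction (determinant α β)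
    determinant-OddFraction α-rational = OddFraction--
      (OddFraction-* (OddFraction-- (β-rational zero) (OddFraction-fromℤ (+ 2))) (α-rational (suc zero)))
      (OddFraction-* (OddFraction-- (β-rational (suc zero)) (OddFraction-fromℤ (+ 2))) (α-rational zero))

-- The bijection `π`, rationality and periodicity

ψ-π : ∀ F G n → ψ (fibred G) (π F G n) ≗ ψ (fibred F) n
ψ-π F G n = proj₂ (proj₂ (ψ-bijective G) (ψ (fibred F) n)) ≈₂-refl

ψ-injective : ∀ F {m n} → ψ (fibred F) m ≗ ψ (fibred F) n → m ≈₂ n
ψ-injective F = proj₁ (ψ-bijective F)

π-inverse : ∀ F G n → π F G (π G F n) ≈₂ n
π-inverse F G n = ψ-injective G λ k → trans (ψ-π F G (π G F n) k) (ψ-π G F n k)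

UltimatelyPeriodic-resp : ∀ {s t} → s ≗ t → UltimatelyPeriodic s → UltimatelyPeriodic t
UltimatelyPeriodic-resp s≗t (N , p , p≢0 , periodic) =
  N , p , p≢0 , λ k N≤k → trans (sym (s≗t (k ℕ.+ p))) (trans (periodic k N≤k) (s≗t k))

ℚ∩ℤ₂-resp : ∀ {m n} → m ≈₂ n → m ∈ ℚ∩ℤ₂ → n ∈ ℚ∩ℤ₂
ℚ∩ℤ₂-resp m≈n = Rational-resp (toℚ₂-cong m≈n)

-- The `G`-expansion of n is the `F`-expansion of `π G F n`, so periodicity of n under `G` is
-- periodicity of `π G F n` under `F`; rationality is carried back and forth by the two maps.
UltimatelyPeriodicOn-transfer : ∀ F G →
  (∀ {n} → n ∈ ℚ∩ℤ₂ → π F G n ∈ ℚ∩ℤ₂) → (∀ {n} → n ∈ ℚ∩ℤ₂ → π G F n ∈ ℚ∩ℤ₂) →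
  F UltimatelyPeriodicOn ℚ∩ℤ₂ → G UltimatelyPeriodicOn ℚ∩ℤ₂
UltimatelyPeriodicOn-transfer F G π-rational π⁻¹-rational (periodic⇒rational , rational⇒periodic) =
    (λ {n} n-periodic → ℚ∩ℤ₂-resp (π-inverse F G n) (π-rational (periodic⇒rational
      (UltimatelyPeriodic-resp (λ k → sym (ψ-π G F n k)) n-periodic))))
  , (λ {n} n-rational → UltimatelyPeriodic-resp (ψ-π G F n)
      (rational⇒periodic (π⁻¹-rational n-rational)))

image-π : ∀ F G →
  (∀ {n} → n ∈ ℚ∩ℤ₂ → π F G n ∈ ℚ∩ℤ₂) → (∀ {n} → n ∈ ℚ∩ℤ₂ → π G F n ∈ ℚ∩ℤ₂) →
  image (π F G) ℚ∩ℤ₂ ≐ ℚ∩ℤ₂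
image-π F G π-rational π⁻¹-rational =
    (λ { (n , n-rational , πn≈m) → ℚ∩ℤ₂-resp πn≈m (π-rational n-rational) })
  , (λ {m} m-rational → π G F m , π⁻¹-rational m-rational , π-inverse F G m)

-- Both sides have the `F`-expansion of n as their `G`-expansion, and a `G`-expansion determines its
-- number.
π≈conjugacy : ∀ {F G α′ α″ β} (F-affine : Affine F α′ β) (G-affine : Affine G α″ β)
  {δ⁻¹} (δ⁻¹-odd : Odd δ⁻¹) (δδ⁻¹≈1 : determinant α′ β *₂ δ⁻¹ ≈₂ fromℤ (+ 1)) →
  ∀ n → π F G n ≈₂ conjugacy F-affine G-affine δ⁻¹-odd δδ⁻¹≈1 n
π≈conjugacy {F} {G} F-affine G-affine δ⁻¹-odd δδ⁻¹≈1 n = ψ-injective G λ k →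
  trans (ψ-π F G n k) (sym (ψ-conjugacy F-affine G-affine δ⁻¹-odd δδ⁻¹≈1 n k))

π-preserves-ℚ∩ℤ₂ : ∀ {F G α′ α″ β} → Affine F α′ β → Affine G α″ β →
  (∀ r → OddFraction (α′ r)) → (∀ r → OddFraction (α″ r)) → (∀ r → OddFraction (β r)) →
  ∀ {n} → n ∈ ℚ∩ℤ₂ → π F G n ∈ ℚ∩ℤ₂
π-preserves-ℚ∩ℤ₂ F-affine G-affine α′-rational α″-rational β-rational {n} n-rational =
  OddFraction⇒ℚ∩ℤ₂ (OddFraction-resp
    (≈₂-sym (π≈conjugacy F-affine G-affine (proj₁ inverse-laws) (proj₂ inverse-laws) n))
    (conjugacy-OddFraction F-affine G-affine (proj₁ inverse-laws) (proj₂ inverse-laws)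
      α′-rational α″-rational β-rational (ℚ∩ℤ₂⇒OddFraction n-rational)))
  where
  inverse-laws = proj₂ (odd-inverse (determinant-odd F-affine))

-- From integral coefficients back to the formula over `ℚ₂`

toℚ₂-determinant : ∀ {a₀ a₁ b₀ b₁} (α β : Fin 2 → ℤ₂) →
  a₀ ≈ℚ₂ toℚ₂ (α zero) → a₁ ≈ℚ₂ toℚ₂ (α (suc zero)) →
  b₀ ≈ℚ₂ toℚ₂ (β zero) → b₁ ≈ℚ₂ toℚ₂ (β (suc zero)) →
  (b₀ - ℤtoℚ₂ (+ 2)) * a₁ - (b₁ - ℤtoℚ₂ (+ 2)) * a₀ ≈ℚ₂ toℚ₂ (determinant α β)
toℚ₂-determinant {a₀} {a₁} {b₀} {b₁} α β a₀≈ a₁≈ b₀≈ b₁≈ = begin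
  (b₀ - ℤtoℚ₂ (+ 2)) * a₁ - (b₁ - ℤtoℚ₂ (+ 2)) * a₀
    ≈⟨ ℚ₂-Ring.+-cong (product (β zero) (α (suc zero)) b₀≈ a₁≈)
                      (ℚ₂-Ring.-‿cong (product (β (suc zero)) (α zero) b₁≈ a₀≈)) ⟩
  toℚ₂ (term (β zero) (α (suc zero))) - toℚ₂ (term (β (suc zero)) (α zero))
    ≈⟨ toℚ₂-- (term (β zero) (α (suc zero))) (term (β (suc zero)) (α zero)) ⟨
  toℚ₂ (determinant α β) ∎
  where
  open SetoidReasoning ℚ₂-Ring.setoid
  term : ℤ₂ → ℤ₂ → ℤ₂
  term y x = (y +₂ -₂ fromℤ (+ 2)) *₂ x
  product : ∀ {a b} y x → b ≈ℚ₂ toℚ₂ y → a ≈ℚ₂ toℚ₂ x →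
            (b - ℤtoℚ₂ (+ 2)) * a ≈ℚ₂ toℚ₂ (term y x)
  product {a} {b} y x b≈ a≈ = begin
    (b - ℤtoℚ₂ (+ 2)) * a
      ≈⟨ ℚ₂-Ring.*-cong (ℚ₂-Ring.+-congʳ b≈) a≈ ⟩
    (toℚ₂ y - ℤtoℚ₂ (+ 2)) * toℚ₂ x
      ≈⟨ ℚ₂-Ring.*-congʳ (ℚ₂-Ring.sym (toℚ₂-- y (fromℤ (+ 2)))) ⟩
    toℚ₂ (y +₂ -₂ fromℤ (+ 2)) * toℚ₂ x
      ≈⟨ toℚ₂-* (y +₂ -₂ fromℤ (+ 2)) x ⟨
    toℚ₂ (term y x) ∎

toℚ₂-cross : ∀ {a b c d} x y z w → a ≈ℚ₂ toℚ₂ x → b ≈ℚ₂ toℚ₂ y → c ≈ℚ₂ toℚ₂ z → d ≈ℚ₂ toℚ₂ w →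
  a * b - c * d ≈ℚ₂ toℚ₂ (x *₂ y +₂ -₂ (z *₂ w))
toℚ₂-cross x y z w a≈ b≈ c≈ d≈ = ℚ₂-Ring.trans
  (ℚ₂-Ring.+-cong (ℚ₂-Ring.*-cong a≈ b≈) (ℚ₂-Ring.-‿cong (ℚ₂-Ring.*-cong c≈ d≈)))
  (ℚ₂-Ring.sym (toℚ₂-- (x *₂ y) (z *₂ w)))

coefficients : ℚ₂ → ℚ₂ → Fin 2 → ℚ₂
coefficients x y zero       = x
coefficients x y (suc zero) = y

linear : ∀ {F a₀ b₀ a₁ b₁} → LinearPolynomial F a₀ b₀ a₁ b₁ →
  ∀ r n → n %2 ≡ r →
  toℚ₂ ((F [ r ]) n) ≈ℚ₂ coefficients a₀ a₁ r + coefficients b₀ b₁ r * toℚ₂ n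
linear (F₀ , F₁) zero       = F₀
linear (F₀ , F₁) (suc zero) = F₁

theorem7p14 :
    (F G : 2AdicSystem) (a₀′ a₁′ a₀″ a₁″ b₀ b₁ : ℚ₂) →
    LinearPolynomial (fibred F) a₀′ b₀ a₁′ b₁ →
    LinearPolynomial (fibred G) a₀″ b₀ a₁″ b₁ →
    WeakCanonical (fibred F) →
    WeakCanonical (fibred G) →
    let 2ℚ = ℤtoℚ₂ (+ 2)
        D  = (b₀ - 2ℚ) * a₁′ - (b₁ - 2ℚ) * a₀′
    in
    (Σ[ D⁻¹ ∈ Invertible 1# _*_ D ]
       (∀ n → toℚ₂ (π F G n) ≈ℚ₂
         ((a₀′ * a₁″ - a₁′ * a₀″)
           + toℚ₂ n * ((b₀ - 2ℚ) * a₁″ - (b₁ - 2ℚ) * a₀″)) * proj₁ D⁻¹))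
    × ( a₀′ ∈ Rational ∩ Integral → a₁′ ∈ Rational ∩ Integral →
        a₀″ ∈ Rational ∩ Integral → a₁″ ∈ Rational ∩ Integral →
        b₀ ∈ Rational ∩ Integral → b₁ ∈ Rational ∩ Integral →
        (image (π F G) ℚ∩ℤ₂ ≐ ℚ∩ℤ₂)
        × (F UltimatelyPeriodicOn ℚ∩ℤ₂ ⇔ G UltimatelyPeriodicOn ℚ∩ℤ₂))
theorem7p14 F G a₀′ a₁′ a₀″ a₁″ b₀ b₁ F-linear G-linear F-canonical G-canonical =
    ((D⁻¹ , D⁻¹*D≈1 , D*D⁻¹≈1) , formula)
  , λ a₀′∈ a₁′∈ a₀″∈ a₁″∈ b₀∈ b₁∈ →
      let α′-rational = rational α′ a′≈α′ (proj₁ a₀′∈) (proj₁ a₁′∈)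
          α″-rational = rational α″ a″≈α″ (proj₁ a₀″∈) (proj₁ a₁″∈)
          β-rational  = rational β b≈β (proj₁ b₀∈) (proj₁ b₁∈)
          π-rational : ∀ {n} → n ∈ ℚ∩ℤ₂ → π F G n ∈ ℚ∩ℤ₂
          π-rational = π-preserves-ℚ∩ℤ₂ F-affine G-affine α′-rational α″-rational β-rational
          π⁻¹-rational : ∀ {n} → n ∈ ℚ∩ℤ₂ → π G F n ∈ ℚ∩ℤ₂
          π⁻¹-rational = π-preserves-ℚ∩ℤ₂ G-affine F-affine α″-rational α′-rational β-rational
      in image-π F G π-rational π⁻¹-rational
       , mk⇔ (UltimatelyPeriodicOn-transfer F G π-rational π⁻¹-rational)
             (UltimatelyPeriodicOn-transfer G F π⁻¹-rational π-rational)
  where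
  D : ℚ₂
  D = (b₀ - ℤtoℚ₂ (+ 2)) * a₁′ - (b₁ - ℤtoℚ₂ (+ 2)) * a₀′

  F-coefficients = affine-coefficients F F-canonical (coefficients a₀′ a₁′) (coefficients b₀ b₁)
    (linear {fibred F} F-linear)
  G-coefficients = affine-coefficients G G-canonical (coefficients a₀″ a₁″) (coefficients b₀ b₁)
    (linear {fibred G} G-linear)

  α′ α″ β β″ : Fin 2 → ℤ₂
  α′ = proj₁ F-coefficients
  α″ = proj₁ G-coefficients
  β  = proj₁ (proj₂ F-coefficients)
  β″ = proj₁ (proj₂ G-coefficients)

  F-affine : Affine F α′ β
  F-affine = proj₁ (proj₂ (proj₂ F-coefficients))
  a′≈α′ = proj₁ (proj₂ (proj₂ (proj₂ F-coefficients)))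
  a″≈α″ = proj₁ (proj₂ (proj₂ (proj₂ G-coefficients)))
  b≈β   = proj₂ (proj₂ (proj₂ (proj₂ F-coefficients)))
  b≈β″  = proj₂ (proj₂ (proj₂ (proj₂ G-coefficients)))

  G-affine : Affine G α″ β
  -- `β` and `β″` both represent the common coefficients b₀ and b₁, and the embedding of `ℤ₂` in
  -- `ℚ₂` is injective.
  G-affine = Affine-resp-β
    (λ r → toℚ₂-injective (ℚ₂-Ring.trans (ℚ₂-Ring.sym (b≈β r)) (b≈β″ r))) (proj₁ (proj₂ (proj₂ G-coefficients)))

  δ = determinant α′ β
  δ⁻¹ = proj₁ (odd-inverse (determinant-odd F-affine))
  δ⁻¹-odd : Odd δ⁻¹
  δ⁻¹-odd = proj₁ (proj₂ (odd-inverse (determinant-odd F-affine)))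
  δδ⁻¹≈1 : δ *₂ δ⁻¹ ≈₂ fromℤ (+ 1)
  δδ⁻¹≈1 = proj₂ (proj₂ (odd-inverse (determinant-odd F-affine)))

  D⁻¹ : ℚ₂
  -- `D` is the image of the odd `δ`, so its inverse can be taken in `ℤ₂`.
  D⁻¹ = toℚ₂ δ⁻¹

  D*D⁻¹≈1 : D * D⁻¹ ≈ℚ₂ 1#
  D*D⁻¹≈1 = ℚ₂-Ring.trans
    (ℚ₂-Ring.*-congʳ (toℚ₂-determinant α′ β
      (a′≈α′ zero) (a′≈α′ (suc zero)) (b≈β zero) (b≈β (suc zero))))
    (toℚ₂-cong δδ⁻¹≈1)

  D⁻¹*D≈1 : D⁻¹ * D ≈ℚ₂ 1#
  D⁻¹*D≈1 = ℚ₂-Ring.trans (ℚ₂-Ring.*-comm D⁻¹ D) D*D⁻¹≈1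

  formula : ∀ n → toℚ₂ (π F G n) ≈ℚ₂
    ((a₀′ * a₁″ - a₁′ * a₀″)
      + toℚ₂ n * ((b₀ - ℤtoℚ₂ (+ 2)) * a₁″ - (b₁ - ℤtoℚ₂ (+ 2)) * a₀″)) * D⁻¹
  formula n = ℚ₂-Ring.trans
    (toℚ₂-cong (π≈conjugacy F-affine G-affine δ⁻¹-odd δδ⁻¹≈1 n))
    (ℚ₂-Ring.trans (toℚ₂-* (A +₂ n *₂ B) δ⁻¹)
      (ℚ₂-Ring.*-congʳ (ℚ₂-Ring.trans (toℚ₂-+ A (n *₂ B))
        (ℚ₂-Ring.+-cong (ℚ₂-Ring.sym A≈) (ℚ₂-Ring.*-congˡ (ℚ₂-Ring.sym B≈))))))
    where
    A = α′ zero *₂ α″ (suc zero) +₂ -₂ (α′ (suc zero) *₂ α″ zero)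
    B = determinant α″ β
    A≈ : a₀′ * a₁″ - a₁′ * a₀″ ≈ℚ₂ toℚ₂ A
    A≈ = toℚ₂-cross (α′ zero) (α″ (suc zero)) (α′ (suc zero)) (α″ zero)
      (a′≈α′ zero) (a″≈α″ (suc zero)) (a′≈α′ (suc zero)) (a″≈α″ zero)
    B≈ : (b₀ - ℤtoℚ₂ (+ 2)) * a₁″ - (b₁ - ℤtoℚ₂ (+ 2)) * a₀″ ≈ℚ₂ toℚ₂ B
    B≈ = toℚ₂-determinant α″ β
      (a″≈α″ zero) (a″≈α″ (suc zero)) (b≈β zero) (b≈β (suc zero))

  rational : ∀ {x y} α → (∀ r → coefficients x y r ≈ℚ₂ toℚ₂ (α r)) →
             Rational x → Rational y → ∀ r → OddFraction (α r)
  rational α a≈α x-rational y-rational zero =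
    Rational-toℚ₂⇒OddFraction (a≈α zero) x-rational
  rational α a≈α x-rational y-rational (suc zero) =
    Rational-toℚ₂⇒OddFraction (a≈α (suc zero)) y-rational
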